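{- There exists an absolute constant $C>0$ such that for every integer $d\ge 1$ and every (finite) $3$-uniform, $d$-regular, linear hypergraph $G$ on $n$ vertices without cross-edges, $$\frac{\log_2 i_2(G)}{n}\;\le\;\frac13+\frac{C}{d},$$ where $i_2(G)$ denotes the number of strong independent sets of $G$.
   Context: A hypergraph $G=(V,E)$ consists of a finite vertex set $V$ and a collection $E$ of subsets of $V$ (edges). It is $r$-uniform if every edge has exactly $r$ vertices; the degree of a vertex $v$ is $|\{e\in E: v\in e\}|$, and $G$ is $d$-regular if every vertex has degree $d$. It is linear if each pair of distinct vertices appears in at most one common edge. Two distinct vertices $u,v$ are neighbors if some edge contains both. A cross-edge in the neighborhood of a vertex $v$ is an edge that contains two (distinct) neighbors $u_1,u_2$ of $v$ but not $v$ itself; $G$ is cross-edge free (without cross-edges) if there is no such edge for any vertex $v$. A strong independent set ($2$-independent set) is a set $I\subseteq V$ with $|I\cap e|<2$ for all $e\in E$; $i_2(G)$ is the number of strong independent sets (including the empty set). -}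

module Defs where

open import Data.Fin using (Fin)
open import Data.Fin.Subset using (Subset; inside; outside; _∈_; _∉_; _∩_; ∣_∣)
open import Data.Fin.Subset.Properties using (_∈?_)
open import Data.Integer using (+_; -[1+_])
open import Data.List using (List; []; _∷_; _++_; map; filter; length)
open import Data.List.Membership.Propositional using () renaming (_∈_ to _∈ₗ_)
open import Data.List.Membership.Propositional.Properties using (∈-map⁺; ∈-map⁻; ∈-++⁺ˡ; ∈-++⁺ʳ)
open import Data.List.Relation.Unary.All using (All; all?; [])
open import Data.List.Relation.Unary.AllPairs using ([]; _∷_)
open import Data.List.Relation.Unary.Any using (here)
open import Data.List.Relation.Unary.Unique.Propositional using (Unique)
open import Data.List.Relation.Unary.Unique.Propositional.Properties using (map⁺; ++⁺)
open import Data.Nat using (ℕ; zero; suc; _*_; _^_; _≤_; _<_; _<?_)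
open import Data.Product using (_×_; _,_; ∃-syntax)
import Data.Rational as ℚ
open ℚ using (ℚ; mkℚ)
import Data.Vec as Vec
open import Data.Vec.Properties using (∷-injectiveʳ)
open import Relation.Binary.PropositionalEquality using (_≡_; _≢_; refl)
open import Relation.Nullary using (¬_)
open import Relation.Unary using (Decidable)

-- The edges form a set of subsets, represented by a duplicate-free list.
record Hypergraph (n : ℕ) : Set where
  field
    edges  : List (Subset n)
    unique : Unique edges

open Hypergraph public

module _ {n : ℕ} (G : Hypergraph n) where

  Uniform : ℕ → Set
  Uniform r = All (λ e → ∣ e ∣ ≡ r) (edges G)

  degree : Fin n → ℕ
  degree v = length (filter (v ∈?_) (edges G))

  Regular : ℕ → Set
  Regular d = ∀ v → degree v ≡ d

  Linear : Set
  Linear = ∀ {u v e f} → u ≢ v →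
           e ∈ₗ edges G → u ∈ e → v ∈ e →
           f ∈ₗ edges G → u ∈ f → v ∈ f →
           e ≡ f

  Neighbors : Fin n → Fin n → Set
  Neighbors u v = u ≢ v × ∃[ e ] (e ∈ₗ edges G × u ∈ e × v ∈ e)

  CrossEdge : Fin n → Subset n → Set
  CrossEdge v e =
    e ∈ₗ edges G × v ∉ e ×
    ∃[ u₁ ] ∃[ u₂ ] (u₁ ≢ u₂ × Neighbors v u₁ × Neighbors v u₂ × u₁ ∈ e × u₂ ∈ e)

  CrossEdgeFree : Set
  CrossEdgeFree = ∀ v e → ¬ CrossEdge v e

  StrongIndependent : Subset n → Set
  StrongIndependent I = All (λ e → ∣ I ∩ e ∣ < 2) (edges G)

  strongIndependent? : Decidable StrongIndependent
  strongIndependent? I = all? (λ e → ∣ I ∩ e ∣ <? 2) (edges G)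

subsets : ∀ n → List (Subset n)
subsets zero    = Vec.[] ∷ []
subsets (suc n) = map (outside Vec.∷_) (subsets n) ++ map (inside Vec.∷_) (subsets n)

∈-subsets : ∀ {n} (p : Subset n) → p ∈ₗ subsets n
∈-subsets Vec.[]            = here refl
∈-subsets (outside Vec.∷ p) = ∈-++⁺ˡ (∈-map⁺ _ (∈-subsets p))
∈-subsets (inside  Vec.∷ p) = ∈-++⁺ʳ _ (∈-map⁺ _ (∈-subsets p))

subsets-unique : ∀ n → Unique (subsets n)
subsets-unique zero    = [] ∷ []
subsets-unique (suc n) =
  ++⁺ (map⁺ ∷-injectiveʳ (subsets-unique n)) (map⁺ ∷-injectiveʳ (subsets-unique n)) disjoint
  where
  disjoint : ∀ {p} → ¬ (p ∈ₗ map (outside Vec.∷_) (subsets n) ×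
                        p ∈ₗ map (inside Vec.∷_) (subsets n))
  disjoint (p∈ , p∈′) with ∈-map⁻ _ p∈ | ∈-map⁻ _ p∈′
  ... | _ , _ , refl | _ , _ , ()

i₂ : ∀ {n} → Hypergraph n → ℕ
i₂ {n} G = length (filter (strongIndependent? G) (subsets n))

-- The comparison of the real number (log₂ m) / n with a rational q, for
-- m, n ≥ 1.  If q = a / b with b > 0, then (log₂ m) / n ≤ a / b means
-- b · log₂ m ≤ n · a, that is, m ^ b ≤ 2 ^ (n · a); when a = - k < 0 the power
-- of 2 is moved to the left.  For n = 0 it is read as log₂ m ≤ n · q.
log₂_/_≤_ : ℕ → ℕ → ℚ → Set
log₂ m / n ≤ mkℚ (+ a)    b-1 _ = m ^ suc b-1 ≤ 2 ^ (n * a)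
log₂ m / n ≤ mkℚ -[1+ k ] b-1 _ = m ^ suc b-1 * 2 ^ (n * suc k) ≤ 1

infix 4 log₂_/_≤_

-- Occupancy method for the hard-core model.  A strong independent set I gets weight
-- λ^|I|, scaled to p^|I| q^(n−|I|) with λ = p / q so that everything stays in ℕ.  Call a
-- vertex w of an edge e free if no vertex of I outside e is adjacent to w.  An uncovered
-- vertex is free in all d of its edges, and an edge with exactly one free vertex w looks
-- open from each of its two other vertices; edges with several free vertices are charged
-- to the pairs (x , e) with x free in e and e open at x.  Fix a vertex x and the part J
-- of I that is not adjacent to x.  Absence of cross-edges and linearity make the set of
-- open edges at x a function of J, and if there are m of them the conditional partition
-- function is at least λ + (1 + λ)^m, while x is uncovered with weight 1 + λ only.
-- Balancing m against this weight gives E|I| ≤ n λ / (3 (1 + λ)) · (1 + c / (1 + λ d)²).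
-- The integral of this bound from 0 to 1 is replaced by steps of size 1/q, with potential
-- (1 + λ) (1 + (d + κ) λ) / (1 + d λ); the last factor is at most 1 + κ / d and pays for
-- the error term.

module Submission where

open import Defs

-- Two extreme local pictures share the value d: with no open edge the bound lets `x` be surely
-- uncovered, and with d open edges their count alone is d while, for large λ d, `x` is almost never
-- uncovered. This tie produces the 1/3. For λ of order 1 / d most edges are open and `x` is still
-- likely to be uncovered, so there the relative error is of constant size and it must decay quickly
-- as λ grows. The rate of decay decides the theorem: log Z at λ = 1 is the integral of E|I| / λ,
-- and 1 / (1 + λ d)² has integral below 1 / d, whereas the first power would cost (log d) / d.
-- Hence a quadratic version of Bernoulli's inequality. The potential is chosen by its logarithmic
-- derivative 1 / (1 + λ) + κ / ((1 + d λ) (1 + (d + κ) λ)), whose second term dominates the error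
-- once κ ≤ d; for smaller d the bound 2^n on the number of sets is within the claim.

module Inequalities where

  open import Data.Nat using (ℕ; zero; suc; _+_; _*_; _^_; _≤_; NonZero; s≤s; ⌊_/2⌋; ⌈_/2⌉; _≤?_; >-nonZero; >-nonZero⁻¹)
  open import Data.Nat.Properties
  open import Data.Nat.Tactic.RingSolver using (solve-∀)
  open import Data.Product using (_,_)
  open import Data.Sum using (inj₁; inj₂)
  open import Relation.Binary.PropositionalEquality using (_≡_; refl; sym; trans; cong; cong₂; subst; subst₂)
  open import Relation.Nullary using (yes; no)

  -- Inequalities of Bernoulli type

  by-slack : ∀ {a b} s → b ≡ a + s → a ≤ b
  by-slack {a} s refl = m≤m+n a s

  -- Bernoulli relative to the larger base v = u + k: in quotients, 1 + n k / v ≤ (v / u)^n.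
  -- `power-step` needs this backward form because its error is relative to the new value.
  bernoulli-suc : ∀ u k n → (u + k + n * k) * u ^ n ≤ (u + k) ^ suc n
  bernoulli-suc u k zero    = ≤-reflexive (cong (_* 1) (+-identityʳ (u + k)))
  bernoulli-suc u k (suc n) = begin
    (u + k + suc n * k) * (u * u ^ n)            ≤⟨ by-slack (k * (k + n * k) * u ^ n) (lemma u k n (u ^ n)) ⟩
    (u + k) * ((u + k + n * k) * u ^ n)          ≤⟨ *-monoʳ-≤ (u + k) (bernoulli-suc u k n) ⟩
    (u + k) * (u + k) ^ suc n                    ∎
    where
    open ≤-Reasoning
    lemma : ∀ u k n t → (u + k) * ((u + k + n * k) * t) ≡ (u + k + suc n * k) * (u * t) + k * (k + n * k) * t
    lemma = solve-∀

  bernoulli : ∀ u k n → u ^ n * (u + n * k) ≤ u * (u + k) ^ n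
  bernoulli u k zero    = ≤-reflexive (trans (*-identityˡ (u + 0)) (trans (+-identityʳ u) (sym (*-identityʳ u))))
  bernoulli u k (suc n) = begin
    u * u ^ n * (u + suc n * k)                  ≡⟨ lemma u k n (u ^ n) ⟩
    u * ((u + k + n * k) * u ^ n)                ≤⟨ *-monoʳ-≤ u (bernoulli-suc u k n) ⟩
    u * (u + k) ^ suc n                          ∎
    where
    open ≤-Reasoning
    lemma : ∀ u k n t → u * t * (u + suc n * k) ≡ u * ((u + k + n * k) * t)
    lemma = solve-∀

  ^-halves : ∀ x n → x ^ n ≡ x ^ ⌊ n /2⌋ * x ^ ⌈ n /2⌉
  ^-halves x n = trans (cong (x ^_) (sym (⌊n/2⌋+⌈n/2⌉≡n n))) (^-distribˡ-+-* x ⌊ n /2⌋ ⌈ n /2⌉)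

  ^-swap : ∀ x a b → (x ^ a) ^ b ≡ (x ^ b) ^ a
  ^-swap x a b = trans (^-*-assoc x a b) (trans (cong (x ^_) (*-comm a b)) (sym (^-*-assoc x b a)))

  -- Bernoulli on each half of the exponent gives two linear factors, hence quadratic growth in `m`.
  -- The 4 is 2 · 2, a factor 2 for replacing `m` by half of it in 1 + m λ; λ ≤ 1 absorbs the
  -- rounding when `m` is odd.
  bernoulli² : ∀ q p m → p ≤ q → q ^ m * ((q + m * p) * (q + m * p)) ≤ 4 * (q * q * (q + p) ^ m)
  bernoulli² q p m p≤q = begin
    q ^ m * ((q + m * p) * (q + m * p))
      ≡⟨ cong (_* ((q + m * p) * (q + m * p))) (^-halves q m) ⟩
    q ^ a * q ^ b * ((q + m * p) * (q + m * p))
      ≤⟨ *-monoʳ-≤ (q ^ a * q ^ b) (*-mono-≤ half-a half-b) ⟩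
    q ^ a * q ^ b * (2 * (q + a * p) * (2 * (q + b * p)))
      ≡⟨ rearr₁ (q ^ a) (q ^ b) (q + a * p) (q + b * p) ⟩
    4 * ((q ^ a * (q + a * p)) * (q ^ b * (q + b * p)))
      ≤⟨ *-monoʳ-≤ 4 (*-mono-≤ (bernoulli q p a) (bernoulli q p b)) ⟩
    4 * ((q * (q + p) ^ a) * (q * (q + p) ^ b))
      ≡⟨ cong (4 *_) (rearr₂ q ((q + p) ^ a) ((q + p) ^ b)) ⟩
    4 * (q * q * ((q + p) ^ a * (q + p) ^ b))
      ≡⟨ cong (λ t → 4 * (q * q * t)) (^-halves (q + p) m) ⟨
    4 * (q * q * (q + p) ^ m) ∎
    where
    open ≤-Reasoning
    a = ⌊ m /2⌋
    b = ⌈ m /2⌉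
    half : ∀ i j → i + j ≡ m → j ≤ suc i → q + m * p ≤ 2 * (q + i * p)
    half i j refl j≤1+i = begin
      q + (i + j) * p        ≤⟨ +-monoʳ-≤ q (*-monoˡ-≤ p (+-monoʳ-≤ i j≤1+i)) ⟩
      q + (i + suc i) * p    ≡⟨ r₁ q i p ⟩
      q + 2 * (i * p) + p    ≤⟨ +-monoʳ-≤ (q + 2 * (i * p)) p≤q ⟩
      q + 2 * (i * p) + q    ≡⟨ r₂ q i p ⟩
      2 * (q + i * p)        ∎
      where
      r₁ : ∀ q i p → q + (i + suc i) * p ≡ q + 2 * (i * p) + p
      r₁ = solve-∀
      r₂ : ∀ q i p → q + 2 * (i * p) + q ≡ 2 * (q + i * p)
      r₂ = solve-∀
    half-a : q + m * p ≤ 2 * (q + a * p)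
    half-a = half a b (⌊n/2⌋+⌈n/2⌉≡n m) (⌊n/2⌋-mono (n≤1+n (suc m)))
    half-b : q + m * p ≤ 2 * (q + b * p)
    half-b = half b a (trans (+-comm b a) (⌊n/2⌋+⌈n/2⌉≡n m)) (m≤n⇒m≤1+n (⌊n/2⌋≤⌈n/2⌉ m))
    rearr₁ : ∀ s t x y → s * t * (2 * x * (2 * y)) ≡ 4 * ((s * x) * (t * y))
    rearr₁ = solve-∀
    rearr₂ : ∀ q x y → (q * x) * (q * y) ≡ q * q * (x * y)
    rearr₂ = solve-∀

  -- Bernoulli for the base 1 - 1 / (x + 1). The variable `g` carries x + 1 - h, so that no
  -- truncated subtraction occurs.
  reverse-bernoulli : ∀ x h g → g + h ≡ suc x → suc x ^ h * g ≤ x ^ h * suc x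
  reverse-bernoulli x zero    g eq = *-monoʳ-≤ 1 (≤-reflexive (trans (sym (+-identityʳ g)) eq))
  reverse-bernoulli x (suc h) g eq = begin
    suc x * suc x ^ h * g        ≡⟨ rearr x g (suc x ^ h) ⟩
    suc x ^ h * (x * g + g)      ≤⟨ *-monoʳ-≤ (suc x ^ h) (+-monoʳ-≤ (x * g) g≤x) ⟩
    suc x ^ h * (x * g + x)      ≡⟨ rearr′ x g (suc x ^ h) ⟩
    x * (suc x ^ h * suc g)      ≤⟨ *-monoʳ-≤ x (reverse-bernoulli x h (suc g) (trans (sym (+-suc g h)) eq)) ⟩
    x * (x ^ h * suc x)          ≡⟨ *-assoc x (x ^ h) (suc x) ⟨
    x * x ^ h * suc x            ∎
    where
    open ≤-Reasoning
    g≤x : g ≤ x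
    g≤x = ≤-trans (m≤m+n g h) (≤-reflexive (suc-injective (trans (sym (+-suc g h)) eq)))
    rearr : ∀ x g t → suc x * t * g ≡ t * (x * g + g)
    rearr = solve-∀
    rearr′ : ∀ x g t → t * (x * g + x) ≡ x * (t * suc g)
    rearr′ = solve-∀

  suc-^-≤-2* : ∀ x h → 2 * h ≤ suc x → suc x ^ h ≤ 2 * x ^ h
  suc-^-≤-2* x h 2h≤ with m≤n⇒∃[o]m+o≡n 2h≤
  ... | o , eq = *-cancelʳ-≤ (suc x ^ h) (2 * x ^ h) (suc x) (begin
    suc x ^ h * suc x             ≤⟨ *-monoʳ-≤ (suc x ^ h) (by-slack o (trans (rr h o) (cong (_+ o) eq))) ⟩
    suc x ^ h * (2 * (h + o))     ≡⟨ rearr (suc x ^ h) (h + o) ⟩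
    2 * (suc x ^ h * (h + o))     ≤⟨ *-monoʳ-≤ 2 (reverse-bernoulli x h (h + o) (trans (rr′ h o) eq)) ⟩
    2 * (x ^ h * suc x)           ≡⟨ *-assoc 2 (x ^ h) (suc x) ⟨
    2 * x ^ h * suc x             ∎)
    where
    open ≤-Reasoning
    rr : ∀ h o → 2 * (h + o) ≡ 2 * h + o + o
    rr = solve-∀
    rr′ : ∀ h o → h + o + h ≡ 2 * h + o
    rr′ = solve-∀
    rearr : ∀ t y → t * (2 * y) ≡ 2 * (t * y)
    rearr = solve-∀

  -- The limiting constant would be e; 4 is a power of 2, which `count-bound` can move into the
  -- exponent. Both halves of `d` are short enough for `suc-^-≤-2*`.
  suc-^-≤-4* : ∀ x d → d ≤ x → suc x ^ d ≤ 4 * x ^ d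
  suc-^-≤-4* x d d≤x = begin
    suc x ^ d                          ≡⟨ ^-halves (suc x) d ⟩
    suc x ^ a * suc x ^ b              ≤⟨ *-mono-≤ (suc-^-≤-2* x a (double a≤b)) (suc-^-≤-2* x b (≤-trans 2b≤1+d (s≤s d≤x))) ⟩
    2 * x ^ a * (2 * x ^ b)            ≡⟨ rearr (x ^ a) (x ^ b) ⟩
    4 * (x ^ a * x ^ b)                ≡⟨ cong (4 *_) (^-halves x d) ⟨
    4 * x ^ d                          ∎
    where
    open ≤-Reasoning
    a = ⌊ d /2⌋
    b = ⌈ d /2⌉
    a≤b = ⌊n/2⌋≤⌈n/2⌉ d
    2b≤1+d : 2 * b ≤ suc d
    2b≤1+d = begin
      2 * b    ≡⟨ cong (b +_) (+-identityʳ b) ⟩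
      b + b    ≤⟨ +-monoʳ-≤ b (⌊n/2⌋≤⌈n/2⌉ (suc d)) ⟩
      ⌊ suc d /2⌋ + ⌈ suc d /2⌉ ≡⟨ ⌊n/2⌋+⌈n/2⌉≡n (suc d) ⟩
      suc d    ∎
    double : ∀ {a} → a ≤ b → 2 * a ≤ suc x
    double a≤b = ≤-trans (*-monoʳ-≤ 2 a≤b) (≤-trans 2b≤1+d (s≤s d≤x))
    rearr : ∀ s t → 2 * s * (2 * t) ≡ 4 * (s * t)
    rearr = solve-∀

  +-^-≤-4^ : ∀ x d k → d ≤ x → (k + x) ^ d ≤ 4 ^ k * x ^ d
  +-^-≤-4^ x d zero    d≤x = ≤-reflexive (sym (+-identityʳ (x ^ d)))
  +-^-≤-4^ x d (suc k) d≤x = begin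
    suc (k + x) ^ d        ≤⟨ suc-^-≤-4* (k + x) d (≤-trans d≤x (m≤n+m x k)) ⟩
    4 * (k + x) ^ d        ≤⟨ *-monoʳ-≤ 4 (+-^-≤-4^ x d k d≤x) ⟩
    4 * (4 ^ k * x ^ d)    ≡⟨ *-assoc 4 (4 ^ k) (x ^ d) ⟨
    4 * 4 ^ k * x ^ d      ∎
    where open ≤-Reasoning

  -- The relative error of the occupancy bound at fugacity λ is c / (1 + λ d)².  The
  -- factors of c come from the three estimates in the second case of local-weights.
  c : ℕ
  c = 6 * (49 * 4)

  -- For κ ≤ d one has L ≤ 2 H, so the surplus κ / (H L) in the logarithmic derivative is worth at
  -- least 2 c / H². One half pays for the occupancy error, the other for the discretisation.
  κ : ℕ
  κ = 4 * c

  square : ℕ → ℕ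
  square x = x * x

  -- In terms of λ, with `m` open and `g` closed edges, d (1 + λ) + m (1 + 3 λ) is compared with (g
  -- + d c / (1 + λ d)²) ((1 + λ)^m + λ). If g λ ≥ 6 the closed edges pay alone. Otherwise λ m is
  -- within 6 of λ d, and the growth of (1 + λ)^m, cut down to a quadratic, pays through the error
  -- term.
  local-weights : ∀ q p m g → p ≤ q →
    let d = m + g; Y = square (q + p * d) in
    (d * (q + p) + m * (q + 3 * p)) * q ^ m * Y ≤
    (g * Y + d * (c * (q * q))) * (q * (q + p) ^ m + p * q ^ m)
  local-weights q p m g p≤q with 6 * q ≤? g * p
  -- The threshold 6: once g (1 + λ) is split off, each open edge costs 2 + 4 λ ≤ 6, which the term
  -- g m λ of Bernoulli covers.
  ... | yes 6q≤gp = begin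
    (d * (q + p) + m * (q + 3 * p)) * q ^ m * Y
      ≤⟨ *-monoˡ-≤ Y (begin
           (d * (q + p) + m * (q + 3 * p)) * q ^ m
             ≤⟨ *-monoˡ-≤ (q ^ m) (begin
                  d * (q + p) + m * (q + 3 * p)
                    ≡⟨ r₁ q p m g ⟩
                  g * (q + p) + m * (2 * q + 4 * p)
                    ≤⟨ +-monoʳ-≤ (g * (q + p)) (*-monoʳ-≤ m (+-monoʳ-≤ (2 * q) (*-monoʳ-≤ 4 p≤q))) ⟩
                  g * (q + p) + m * (2 * q + 4 * q)
                    ≡⟨ r₂ q p m g ⟩
                  g * (q + p) + m * (6 * q)
                    ≤⟨ +-monoʳ-≤ (g * (q + p)) (*-monoʳ-≤ m 6q≤gp) ⟩
                  g * (q + p) + m * (g * p)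
                    ≡⟨ r₃ q p m g ⟩
                  g * (q + m * p + p) ∎) ⟩
           g * (q + m * p + p) * q ^ m
             ≡⟨ r₄ g (q + m * p) p (q ^ m) ⟩
           g * (q ^ m * (q + m * p) + p * q ^ m)
             ≤⟨ *-monoʳ-≤ g (+-monoˡ-≤ (p * q ^ m) (bernoulli q p m)) ⟩
           g * (q * (q + p) ^ m + p * q ^ m) ∎) ⟩
    g * R * Y
      ≤⟨ by-slack (d * (c * (q * q)) * R) (r₅ g Y R (d * (c * (q * q)))) ⟩
    (g * Y + d * (c * (q * q))) * R ∎
    where
    open ≤-Reasoning
    d = m + g
    Y = square (q + p * d)
    R = q * (q + p) ^ m + p * q ^ m
    r₁ : ∀ q p m g → (m + g) * (q + p) + m * (q + 3 * p) ≡ g * (q + p) + m * (2 * q + 4 * p)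
    r₁ = solve-∀
    r₂ : ∀ q p m g → g * (q + p) + m * (2 * q + 4 * q) ≡ g * (q + p) + m * (6 * q)
    r₂ = solve-∀
    r₃ : ∀ q p m g → g * (q + p) + m * (g * p) ≡ g * (q + m * p + p)
    r₃ = solve-∀
    r₄ : ∀ g x p t → g * (x + p) * t ≡ g * (t * x + p * t)
    r₄ = solve-∀
    r₅ : ∀ g y r e → (g * y + e) * r ≡ g * r * y + e * r
    r₅ = solve-∀
  -- Here 6 bounds the cost per edge, 49 is the square of 7 in 1 + λ d ≤ 7 (1 + λ m), and 4 comes
  -- from `bernoulli²`.
  ... | no 6q≰gp = begin
    (d * (q + p) + m * (q + 3 * p)) * q ^ m * Y
      ≤⟨ *-mono-≤ (*-monoˡ-≤ (q ^ m) coefficient) (*-mono-≤ base base) ⟩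
    6 * (d * q) * q ^ m * (7 * (q + m * p) * (7 * (q + m * p)))
      ≡⟨ r₁ (d * q) (q ^ m) (q + m * p) ⟩
    6 * (49 * (d * q * (q ^ m * square (q + m * p))))
      ≤⟨ *-monoʳ-≤ 6 (*-monoʳ-≤ 49 (*-monoʳ-≤ (d * q) (bernoulli² q p m p≤q))) ⟩
    6 * (49 * (d * q * (4 * (q * q * (q + p) ^ m))))
      ≡⟨ r₂ d q ((q + p) ^ m) ⟩
    d * (6 * (49 * 4) * (q * q)) * (q * (q + p) ^ m)
      ≤⟨ *-mono-≤ (m≤n+m (d * (c * (q * q))) (g * Y)) (m≤m+n (q * (q + p) ^ m) (p * q ^ m)) ⟩
    (g * Y + d * (c * (q * q))) * (q * (q + p) ^ m + p * q ^ m) ∎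
    where
    open ≤-Reasoning
    d = m + g
    Y = square (q + p * d)
    gp≤6q : g * p ≤ 6 * q
    gp≤6q = <⇒≤ (≰⇒> 6q≰gp)
    coefficient : d * (q + p) + m * (q + 3 * p) ≤ 6 * (d * q)
    coefficient = begin
      d * (q + p) + m * (q + 3 * p)
        ≤⟨ +-mono-≤ (*-monoʳ-≤ d (+-monoʳ-≤ q p≤q)) (*-mono-≤ (m≤m+n m g) (+-monoʳ-≤ q (*-monoʳ-≤ 3 p≤q))) ⟩
      d * (q + q) + d * (q + 3 * q)
        ≡⟨ r d q ⟩
      6 * (d * q) ∎
      where
      r : ∀ d q → d * (q + q) + d * (q + 3 * q) ≡ 6 * (d * q)
      r = solve-∀
    base : q + p * d ≤ 7 * (q + m * p)
    base = begin
      q + p * (m + g)          ≡⟨ r q p m g ⟩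
      q + m * p + g * p        ≤⟨ +-monoʳ-≤ (q + m * p) gp≤6q ⟩
      q + m * p + 6 * q        ≤⟨ by-slack (6 * (m * p)) (r′ q (m * p)) ⟩
      7 * (q + m * p)          ∎
      where
      r : ∀ q p m g → q + p * (m + g) ≡ q + m * p + g * p
      r = solve-∀
      r′ : ∀ q x → 7 * (q + x) ≡ q + x + 6 * q + 6 * x
      r′ = solve-∀
    r₁ : ∀ x t y → 6 * x * t * (7 * y * (7 * y)) ≡ 6 * (49 * (x * (t * (y * y))))
    r₁ = solve-∀
    r₂ : ∀ d q v → 6 * (49 * (d * q * (4 * (q * q * v)))) ≡ d * (6 * (49 * 4) * (q * q)) * (q * v)
    r₂ = solve-∀

  -- The contribution m A of the open edges uses up part of d Y A and leaves g Y A for `U` and `Q`.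
  -- Here `w` is the weight of J, in which the class total `A` and the two upper bounds are all
  -- measured.
  local-bound : ∀ q p m g A U Q w .{{_ : NonZero q}} → p ≤ q →
    (q * (q + p) ^ m + p * q ^ m) * w ≤ q * q ^ m * A →
    q * U ≤ (q + p) * w →
    q * Q ≤ m * (q + 3 * p) * w →
    let d = m + g; Y = square (q + p * d) in
    (m * A + d * U + Q) * Y ≤ d * (Y + c * (q * q)) * A
  local-bound q p m g A U Q w {{q≢0}} p≤q hA hU hQ = begin
    (m * A + d * U + Q) * Y                            ≡⟨ r₁ m A d U Q Y ⟩
    m * A * Y + (d * U + Q) * Y                        ≤⟨ +-monoʳ-≤ (m * A * Y) main ⟩
    m * A * Y + (g * Y + d * (c * (q * q))) * A        ≡⟨ r₂ m g A Y (c * (q * q)) ⟩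
    d * (Y + c * (q * q)) * A                          ∎
    where
    open ≤-Reasoning
    d = m + g
    Y = square (q + p * d)
    G = g * Y + d * (c * (q * q))
    T = q ^ m
    r₁ : ∀ m A d U Q Y → (m * A + d * U + Q) * Y ≡ m * A * Y + (d * U + Q) * Y
    r₁ = solve-∀
    r₂ : ∀ m g A Y e → m * A * Y + (g * Y + (m + g) * e) * A ≡ (m + g) * (Y + e) * A
    r₂ = solve-∀
    r₃ : ∀ q T d U Q Y → q * T * ((d * U + Q) * Y) ≡ (d * (q * U) + q * Q) * T * Y
    r₃ = solve-∀
    r₄ : ∀ d x m y w T Y → (d * (x * w) + m * y * w) * T * Y ≡ (d * x + m * y) * T * Y * w
    r₄ = solve-∀
    r₅ : ∀ G x A → G * (x * A) ≡ x * (G * A)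
    r₅ = solve-∀
    instance
      q*T≢0 : NonZero (q * T)
      q*T≢0 = m*n≢0 q T {{q≢0}} {{m^n≢0 q m {{q≢0}}}}
    main : (d * U + Q) * Y ≤ G * A
    main = *-cancelˡ-≤ (q * T) (begin
      q * T * ((d * U + Q) * Y)                                    ≡⟨ r₃ q T d U Q Y ⟩
      (d * (q * U) + q * Q) * T * Y
        ≤⟨ *-monoˡ-≤ Y (*-monoˡ-≤ T (+-mono-≤ (*-monoʳ-≤ d hU) hQ)) ⟩
      (d * ((q + p) * w) + m * (q + 3 * p) * w) * T * Y            ≡⟨ r₄ d (q + p) m (q + 3 * p) w T Y ⟩
      (d * (q + p) + m * (q + 3 * p)) * T * Y * w                  ≤⟨ *-monoˡ-≤ w (local-weights q p m g p≤q) ⟩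
      G * (q * (q + p) ^ m + p * T) * w                            ≡⟨ *-assoc G _ w ⟩
      G * ((q * (q + p) ^ m + p * T) * w)                          ≤⟨ *-monoʳ-≤ G hA ⟩
      G * (q * T * A)                                              ≡⟨ r₅ G (q * T) A ⟩
      q * T * (G * A)                                              ∎)

  -- The integral over λ as a sequence of discrete steps

  cube : ℕ → ℕ
  cube x = x * x * x

  -- For a ≥ b, a³ - b³ ≤ 3 a² (a - b). Cubing Z avoids a fractional power 1/3 of the potential.
  cube-step : ∀ E D a b → 3 * E * a ≤ 3 * E * b + D * a → E * cube a ≤ E * cube b + D * cube a
  cube-step E D a b h with ≤-total a b
  ... | inj₁ a≤b = ≤-trans (*-monoʳ-≤ E (*-mono-≤ (*-mono-≤ a≤b a≤b) a≤b)) (m≤m+n _ _)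
  ... | inj₂ b≤a with m≤n⇒∃[o]m+o≡n b≤a
  ...   | t , refl = begin
    E * cube (b + t)                                          ≤⟨ by-slack (E * (t * (3 * b * t + 2 * t * t))) (r₁ E b t) ⟩
    E * cube b + 3 * E * t * ((b + t) * (b + t))               ≤⟨ +-monoʳ-≤ (E * cube b) (*-monoˡ-≤ _ 3Et≤) ⟩
    E * cube b + D * (b + t) * ((b + t) * (b + t))             ≡⟨ r₂ (E * cube b) D (b + t) ⟩
    E * cube b + D * cube (b + t)                              ∎
    where
    open ≤-Reasoning
    r₁ : ∀ E b t → E * (b * b * b) + 3 * E * t * ((b + t) * (b + t)) ≡
                   E * ((b + t) * (b + t) * (b + t)) + E * (t * (3 * b * t + 2 * t * t))
    r₁ = solve-∀
    r₂ : ∀ x D a → x + D * a * (a * a) ≡ x + D * (a * a * a)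
    r₂ = solve-∀
    3Et≤ : 3 * E * t ≤ D * (b + t)
    3Et≤ = +-cancelˡ-≤ (3 * E * b) _ _ (≤-trans (≤-reflexive (sym (*-distribˡ-+ (3 * E) b t))) h)

  -- Put v = u + k. The first hypothesis is a (1 - n F / E) ≤ b; the second gives F / E ≤ k / (v + n
  -- k), so 1 - n F / E is at least v / (v + n k). What remains is (v + n k) / v ≤ (v / u)^n, which
  -- is `bernoulli-suc`.
  power-step : ∀ E F n u k a b .{{_ : NonZero E}} .{{_ : NonZero (u + k)}} →
    E * a ≤ E * b + n * F * a → F * (u + k + n * k) ≤ E * k → a * u ^ n ≤ b * (u + k) ^ n
  power-step E F n u k a b hE hF = *-cancelʳ-≤ _ _ v (begin
    a * u ^ n * v                     ≡⟨ r₁ a (u ^ n) v ⟩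
    a * v * u ^ n                     ≤⟨ *-monoˡ-≤ (u ^ n) av≤ ⟩
    b * (v + n * k) * u ^ n           ≤⟨ ≤-reflexive (*-assoc b _ _) ⟩
    b * ((v + n * k) * u ^ n)         ≤⟨ *-monoʳ-≤ b (bernoulli-suc u k n) ⟩
    b * (v * v ^ n)                   ≡⟨ r₂ b v (v ^ n) ⟩
    b * v ^ n * v                     ∎)
    where
    open ≤-Reasoning
    v = u + k
    r₁ : ∀ a t v → a * t * v ≡ a * v * t
    r₁ = solve-∀
    r₂ : ∀ a v t → a * (v * t) ≡ a * t * v
    r₂ = solve-∀
    r₄ : ∀ E a v n k → E * (a * v) + n * k * E * a ≡ (v + n * k) * (E * a)
    r₄ = solve-∀
    r₅ : ∀ E b x n F a → x * (E * b + n * F * a) ≡ E * (b * x) + n * (F * x) * a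
    r₅ = solve-∀
    r₆ : ∀ E k n a → n * (E * k) * a ≡ n * k * E * a
    r₆ = solve-∀
    av≤ : a * v ≤ b * (v + n * k)
    av≤ = *-cancelˡ-≤ E (+-cancelʳ-≤ (n * k * E * a) _ _ (begin
      E * (a * v) + n * k * E * a                        ≡⟨ r₄ E a v n k ⟩
      (v + n * k) * (E * a)                              ≤⟨ *-monoʳ-≤ (v + n * k) hE ⟩
      (v + n * k) * (E * b + n * F * a)                  ≡⟨ r₅ E b (v + n * k) n F a ⟩
      E * (b * (v + n * k)) + n * (F * (v + n * k)) * a  ≤⟨ +-monoʳ-≤ _ (*-monoˡ-≤ a (*-monoʳ-≤ n hF)) ⟩
      E * (b * (v + n * k)) + n * (E * k) * a            ≡⟨ cong (E * (b * (v + n * k)) +_) (r₆ E k n a) ⟩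
      E * (b * (v + n * k)) + n * k * E * a              ∎))

  -- Here `k` is the exact increment H′ r L - r₁ L′ H of the cross-multiplied potential: L′ H stems
  -- from the factor 1 + λ, and κ q r is the surplus. The main terms cancel and leave κ q r r₁ H² to
  -- cover both the occupancy error and the second-order term n k F.
  potential-step : ∀ n q p′ d → let p = suc p′ in
    κ ≤ d → p ≤ q → n * ((1 + c) * (κ + 2 * square (1 + d))) ≤ q →
    let r₁ = q + p′; r = q + p; H′ = q + d * p′; H = H′ + d; L′ = q + (d + κ) * p′; L = L′ + (d + κ)
        k = κ * q * r + L′ * H; F = square H + c * (q * q) in
    F * (r₁ * L′ * H + k + n * k) ≤ square H * r * k
  potential-step n q p′ d κ≤d p≤q big = begin
    F * (r₁ * L′ * H + k + n * k)                                        ≡⟨ cong (λ r → F * (r₁ * L′ * H + (κ * q * r + L′ * H) + n * k)) r≡ ⟩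
    F * (r₁ * L′ * H + (κ * q * suc r₁ + L′ * H) + n * k)                ≡⟨ cong (λ x → F * (x + n * k)) v≡ ⟩
    F * (suc r₁ * H′ * L + n * k)                                        ≡⟨ e₁ (square H) (c * (q * q)) (suc r₁ * H′ * L) (n * k) ⟩
    square H * (suc r₁ * H′ * L) + (c * (q * q) * (suc r₁ * H′ * L) + n * k * F)
      ≤⟨ +-monoʳ-≤ (square H * (suc r₁ * H′ * L)) rest ⟩
    square H * (suc r₁ * H′ * L) + κ * q * suc r₁ * r₁ * square H        ≡⟨ e₂ (square H) (suc r₁ * H′ * L) κ q r₁ ⟩
    square H * (suc r₁ * H′ * L + κ * q * suc r₁ * r₁)                   ≡⟨ cong (λ x → square H * (x + κ * q * suc r₁ * r₁)) v≡ ⟨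
    square H * (r₁ * L′ * H + (κ * q * suc r₁ + L′ * H) + κ * q * suc r₁ * r₁)
                                                                         ≡⟨ e₃ (square H) (L′ * H) r₁ (κ * q) L′ H ⟩
    square H * suc r₁ * (κ * q * suc r₁ + L′ * H)                        ≡⟨ cong (λ r → square H * r * (κ * q * r + L′ * H)) r≡ ⟨
    square H * r * k                                                     ∎
    where
    open ≤-Reasoning
    p = suc p′
    r₁ = q + p′
    r = q + p
    H′ = q + d * p′
    H = H′ + d
    L′ = q + (d + κ) * p′
    L = L′ + (d + κ)
    k = κ * q * r + L′ * H
    F = square H + c * (q * q)
    B = κ + 2 * square (1 + d)
    r≡ : r ≡ suc r₁
    r≡ = +-suc q p′
    v≡ : r₁ * L′ * H + (κ * q * suc r₁ + L′ * H) ≡ suc r₁ * H′ * L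
    v≡ = e q p′ d κ
      where
      e : ∀ q p′ d κ → (q + p′) * (q + (d + κ) * p′) * (q + d * p′ + d) +
            (κ * q * suc (q + p′) + (q + (d + κ) * p′) * (q + d * p′ + d)) ≡
          suc (q + p′) * (q + d * p′) * (q + (d + κ) * p′ + (d + κ))
      e = solve-∀
    e₁ : ∀ h x v w → (h + x) * (v + w) ≡ h * v + (x * v + w * (h + x))
    e₁ = solve-∀
    e₂ : ∀ h v κ q r₁ → h * v + κ * q * suc r₁ * r₁ * h ≡ h * (v + κ * q * suc r₁ * r₁)
    e₂ = solve-∀
    e₃ : ∀ h x r₁ y L′ H → h * (r₁ * L′ * H + (y * suc r₁ + L′ * H) + y * suc r₁ * r₁) ≡
                           h * suc r₁ * (y * suc r₁ + L′ * H)
    e₃ = solve-∀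
    H′≤H : H′ ≤ H
    H′≤H = m≤m+n H′ d
    q≤H : q ≤ H
    q≤H = ≤-trans (m≤m+n q (d * p′)) H′≤H
    L≤2H : L ≤ 2 * H
    L≤2H = begin
      q + (d + κ) * p′ + (d + κ)   ≤⟨ +-mono-≤ (+-monoʳ-≤ q (*-monoˡ-≤ p′ (+-monoʳ-≤ d κ≤d))) (+-monoʳ-≤ d κ≤d) ⟩
      q + (d + d) * p′ + (d + d)   ≤⟨ by-slack q (e q d p′) ⟩
      2 * H                        ∎
      where
      e : ∀ q d p′ → 2 * (q + d * p′ + d) ≡ q + (d + d) * p′ + (d + d) + q
      e = solve-∀
    H≤ : H ≤ (1 + d) * q
    H≤ = begin
      q + d * p′ + d       ≡⟨ e q d p′ ⟩
      q + d * suc p′       ≤⟨ +-monoʳ-≤ q (*-monoʳ-≤ d p≤q) ⟩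
      q + d * q            ∎
      where
      e : ∀ q d p′ → q + d * p′ + d ≡ q + d * suc p′
      e = solve-∀
    -- From H ≤ (1 + d) q the increment is of order q r. This is the origin of κ + 2 (1 + d)² in
    -- `big`.
    k≤ : k ≤ B * (q * suc r₁)
    k≤ = begin
      κ * q * r + L′ * H                      ≤⟨ +-mono-≤ (≤-reflexive (cong (κ * q *_) r≡)) (*-monoˡ-≤ H (≤-trans (m≤m+n L′ (d + κ)) L≤2H)) ⟩
      κ * q * suc r₁ + 2 * H * H              ≤⟨ +-monoʳ-≤ (κ * q * suc r₁) (*-mono-≤ (*-monoʳ-≤ 2 H≤) H≤) ⟩
      κ * q * suc r₁ + 2 * ((1 + d) * q) * ((1 + d) * q)
                                              ≡⟨ e κ q (suc r₁) (1 + d) ⟩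
      κ * (q * suc r₁) + 2 * square (1 + d) * (q * q)
        ≤⟨ +-monoʳ-≤ (κ * (q * suc r₁)) (*-monoʳ-≤ (2 * square (1 + d)) (*-monoʳ-≤ q (m≤n⇒m≤1+n (m≤m+n q p′)))) ⟩
      κ * (q * suc r₁) + 2 * square (1 + d) * (q * suc r₁)
                                              ≡⟨ *-distribʳ-+ (q * suc r₁) κ (2 * square (1 + d)) ⟨
      B * (q * suc r₁)                        ∎
      where
      e : ∀ κ q s x → κ * q * s + 2 * (x * q) * (x * q) ≡ κ * (q * s) + 2 * (x * x) * (q * q)
      e = solve-∀
    -- The budget is κ = 4 c: L ≤ 2 H makes the occupancy error cost 2 c, and `big` brings the
    -- discretisation term below the other 2 c.
    rest : c * (q * q) * (suc r₁ * H′ * L) + n * k * F ≤ κ * q * suc r₁ * r₁ * square H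
    rest = begin
      c * (q * q) * (suc r₁ * H′ * L) + n * k * F
        ≤⟨ +-mono-≤ (*-monoʳ-≤ (c * (q * q)) (*-mono-≤ (*-monoʳ-≤ (suc r₁) H′≤H) L≤2H))
                    (*-mono-≤ (*-monoʳ-≤ n k≤) (+-monoʳ-≤ (square H) (*-monoʳ-≤ c (*-mono-≤ q≤H q≤H)))) ⟩
      c * (q * q) * (suc r₁ * H * (2 * H)) + n * (B * (q * suc r₁)) * (square H + c * square H)
        ≡⟨ e₄ c q (suc r₁) H n B ⟩
      2 * c * (q * (q * suc r₁)) * square H + n * ((1 + c) * B) * (q * suc r₁ * square H)
        ≤⟨ +-monoʳ-≤ (2 * c * (q * (q * suc r₁)) * square H) (*-monoˡ-≤ (q * suc r₁ * square H) big) ⟩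
      2 * c * (q * (q * suc r₁)) * square H + q * (q * suc r₁ * square H)
        ≤⟨ +-monoʳ-≤ (2 * c * (q * (q * suc r₁)) * square H) (m≤n*m (q * (q * suc r₁ * square H)) (2 * c)) ⟩
      2 * c * (q * (q * suc r₁)) * square H + 2 * c * (q * (q * suc r₁ * square H))
        ≡⟨ e₅ c q (suc r₁) (square H) ⟩
      κ * q * suc r₁ * q * square H
        ≤⟨ *-monoˡ-≤ (square H) (*-monoʳ-≤ (κ * q * suc r₁) (m≤m+n q p′)) ⟩
      κ * q * suc r₁ * r₁ * square H ∎
      where
      e₄ : ∀ c q s H n B → c * (q * q) * (s * H * (2 * H)) + n * (B * (q * s)) * (H * H + c * (H * H)) ≡
           2 * c * (q * (q * s)) * (H * H) + n * ((1 + c) * B) * (q * s * (H * H))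
      e₄ = solve-∀
      e₅ : ∀ c q s h → 2 * c * (q * (q * s)) * h + 2 * c * (q * (q * s * h)) ≡ 4 * c * q * s * q * h
      e₅ = solve-∀

  ^-distribʳ-* : ∀ a b n → (a * b) ^ n ≡ a ^ n * b ^ n
  ^-distribʳ-* a b zero    = refl
  ^-distribʳ-* a b (suc n) = trans (cong (a * b *_) (^-distribʳ-* a b n)) (r a b (a ^ n) (b ^ n))
    where
    r : ∀ a b s t → a * b * (s * t) ≡ a * s * (b * t)
    r = solve-∀

  module Potential (n q d : ℕ) {{q≢0 : NonZero q}} (Z : ℕ → ℕ) (κ≤d : κ ≤ d)
    (fine : n * ((1 + c) * (κ + 2 * square (1 + d))) ≤ q) where

    H L : ℕ → ℕ
    H p = q + d * p
    L p = q + (d + κ) * p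

    -- Only the numerator of the potential; `H` is the denominator. The factor `q * q` raises the
    -- degree in p and q to 4, the degree per vertex of `cube (Z p) * H p ^ n`.
    potential : ℕ → ℕ
    potential p = q * q * ((q + p) * L p)

    q+p≢0 : ∀ p → NonZero (q + p)
    q+p≢0 p = >-nonZero (≤-trans (>-nonZero⁻¹ q) (m≤m+n q p))

    H-suc : ∀ p e → q + e * suc p ≡ q + e * p + e
    H-suc p e = trans (cong (q +_) (trans (*-suc e p) (+-comm e (e * p)))) (sym (+-assoc q (e * p) e))

    potential-bound :
      (∀ p′ → suc p′ ≤ q → let p = suc p′; E = square (H p) * (q + p) in
        3 * E * Z p ≤ 3 * E * Z p′ + n * (square (H p) + c * (q * q)) * Z p) →
      Z 0 ≤ q ^ n → ∀ p → p ≤ q → cube (Z p) * H p ^ n ≤ potential p ^ n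
    potential-bound step Z0 zero p≤q = begin
      cube (Z 0) * (q + d * 0) ^ n                     ≡⟨ cong (λ y → cube (Z 0) * y ^ n) (H0 d) ⟩
      cube (Z 0) * q ^ n                               ≤⟨ *-monoˡ-≤ (q ^ n) (*-mono-≤ (*-mono-≤ Z0 Z0) Z0) ⟩
      q ^ n * q ^ n * q ^ n * q ^ n                    ≡⟨ r (q ^ n) ⟩
      q ^ n * q ^ n * (q ^ n * q ^ n)                  ≡⟨ cong₂ _*_ (^-distribʳ-* q q n) (^-distribʳ-* q q n) ⟨
      (q * q) ^ n * (q * q) ^ n                        ≡⟨ ^-distribʳ-* (q * q) (q * q) n ⟨
      (q * q * (q * q)) ^ n                            ≡⟨ cong (λ x → (q * q * x) ^ n) (cong₂ _*_ (+-identityʳ q) (H0 (d + κ))) ⟨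
      (q * q * ((q + 0) * (q + (d + κ) * 0))) ^ n      ∎
      where
      open ≤-Reasoning
      H0 : ∀ e → q + e * 0 ≡ q
      H0 e = trans (cong (q +_) (*-zeroʳ e)) (+-identityʳ q)
      r : ∀ x → x * x * x * x ≡ x * x * (x * x)
      r = solve-∀
    -- Cross-multiplying by `potential p′ ^ n` turns the ratio of consecutive potentials into (u +
    -- k) / u, the shape that `power-step` expects.
    potential-bound step Z0 (suc p′) p≤q = *-cancelʳ-≤ _ _ (potential p′ ^ n) {{m^n≢0 (potential p′) n {{pot≢0}}}} (begin
      cube (Z p) * H p ^ n * potential p′ ^ n
        ≡⟨ cong (cube (Z p) * H p ^ n *_) (^-distribʳ-* (q * q) (r₁ * L p′) n) ⟩
      cube (Z p) * H p ^ n * ((q * q) ^ n * (r₁ * L p′) ^ n)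
        ≡⟨ e₁ (cube (Z p)) (H p ^ n) ((q * q) ^ n) ((r₁ * L p′) ^ n) ⟩
      cube (Z p) * ((r₁ * L p′) ^ n * H p ^ n) * (q * q) ^ n
        ≡⟨ cong (λ x → cube (Z p) * x * (q * q) ^ n) (^-distribʳ-* (r₁ * L p′) (H p) n) ⟨
      cube (Z p) * u ^ n * (q * q) ^ n
        ≤⟨ *-monoˡ-≤ ((q * q) ^ n) (power-step (square (H p) * r) (square (H p) + c * (q * q)) n u k (cube (Z p)) (cube (Z p′)) {{E≢0}} {{v≢0}}
             (cube-step (square (H p) * r) (n * (square (H p) + c * (q * q))) (Z p) (Z p′) (step p′ p≤q)) κ-ok) ⟩
      cube (Z p′) * (u + k) ^ n * (q * q) ^ n
        ≡⟨ cong (λ x → cube (Z p′) * x ^ n * (q * q) ^ n) v≡ ⟩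
      cube (Z p′) * (H p′ * (r * L p)) ^ n * (q * q) ^ n
        ≡⟨ cong (λ x → cube (Z p′) * x * (q * q) ^ n) (^-distribʳ-* (H p′) (r * L p) n) ⟩
      cube (Z p′) * (H p′ ^ n * (r * L p) ^ n) * (q * q) ^ n
        ≡⟨ e₂ (cube (Z p′)) (H p′ ^ n) ((r * L p) ^ n) ((q * q) ^ n) ⟩
      cube (Z p′) * H p′ ^ n * ((q * q) ^ n * (r * L p) ^ n)
        ≡⟨ cong (cube (Z p′) * H p′ ^ n *_) (^-distribʳ-* (q * q) (r * L p) n) ⟨
      cube (Z p′) * H p′ ^ n * potential p ^ n
        ≤⟨ *-monoˡ-≤ (potential p ^ n) (potential-bound step Z0 p′ (<⇒≤ p≤q)) ⟩
      potential p′ ^ n * potential p ^ n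
        ≡⟨ *-comm (potential p′ ^ n) (potential p ^ n) ⟩
      potential p ^ n * potential p′ ^ n ∎)
      where
      open ≤-Reasoning
      p = suc p′
      r₁ = q + p′
      r = q + p
      u = r₁ * L p′ * H p
      k = κ * q * r + L p′ * H p
      instance
        pot≢0 : NonZero (potential p′)
        pot≢0 = m*n≢0 (q * q) (r₁ * L p′) {{m*n≢0 q q}} {{m*n≢0 r₁ (L p′) {{q+p≢0 p′}} {{q+p≢0 _}}}}
        H≢0 : NonZero (H p)
        H≢0 = q+p≢0 _
        E≢0 : NonZero (square (H p) * r)
        E≢0 = m*n≢0 (square (H p)) r {{m*n≢0 (H p) (H p)}} {{q+p≢0 p}}
      v≡ : u + k ≡ H p′ * (r * L p)
      v≡ = e q p′ d κ
        where
        e : ∀ q p′ d κ → (q + p′) * (q + (d + κ) * p′) * (q + d * suc p′) +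
              (κ * q * (q + suc p′) + (q + (d + κ) * p′) * (q + d * suc p′)) ≡
            (q + d * p′) * ((q + suc p′) * (q + (d + κ) * suc p′))
        e = solve-∀
      v≢0 : NonZero (u + k)
      v≢0 = subst NonZero (sym v≡) (m*n≢0 (H p′) (r * L p) {{q+p≢0 _}} {{m*n≢0 r (L p) {{q+p≢0 _}} {{q+p≢0 _}}}})
      κ-ok : (square (H p) + c * (q * q)) * (u + k + n * k) ≤ square (H p) * r * k
      κ-ok = subst (λ h → let k = κ * q * r + L p′ * h in
                          (square h + c * (q * q)) * (r₁ * L p′ * h + k + n * k) ≤ square h * r * k)
               (sym (H-suc p′ d)) (potential-step n q p′ d κ≤d p≤q fine)
      e₁ : ∀ a h s t → a * h * (s * t) ≡ a * (t * h) * s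
      e₁ = solve-∀
      e₂ : ∀ a h s t → a * (h * s) * t ≡ a * h * (t * s)
      e₂ = solve-∀

  -- At λ = 1 the potential is 2 (1 + d + e) / (1 + d). Its d-th power is 2^d (1 + e / (1 + d))^d,
  -- and the second factor is at most 4^e however large `d` is.
  count-bound : ∀ n q d e i {{_ : NonZero q}} →
    cube (i * q ^ n) * (q + d * q) ^ n ≤ (q * q * ((q + q) * (q + (d + e) * q))) ^ n →
    i ^ (3 * d) ≤ 2 ^ (n * (d + 2 * e))
  count-bound n q d e i h = *-cancelʳ-≤ _ _ (((1 + d) ^ n) ^ d) {{m^n≢0 ((1 + d) ^ n) d {{m^n≢0 (1 + d) n}}}} (begin
    i ^ (3 * d) * ((1 + d) ^ n) ^ d              ≡⟨ cong (_* ((1 + d) ^ n) ^ d) (trans (sym (^-*-assoc i 3 d)) (cong (_^ d) (i³ i))) ⟩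
    cube i ^ d * ((1 + d) ^ n) ^ d               ≡⟨ ^-distribʳ-* (cube i) ((1 + d) ^ n) d ⟨
    (cube i * (1 + d) ^ n) ^ d                   ≤⟨ ^-monoˡ-≤ d reduced ⟩
    ((2 * (e + (1 + d))) ^ n) ^ d                ≡⟨ ^-swap (2 * (e + (1 + d))) n d ⟩
    ((2 * (e + (1 + d))) ^ d) ^ n                ≡⟨ cong (_^ n) (^-distribʳ-* 2 (e + (1 + d)) d) ⟩
    (2 ^ d * (e + (1 + d)) ^ d) ^ n              ≤⟨ ^-monoˡ-≤ n (*-monoʳ-≤ (2 ^ d) (+-^-≤-4^ (1 + d) d e (n≤1+n d))) ⟩
    (2 ^ d * (4 ^ e * (1 + d) ^ d)) ^ n          ≡⟨ cong (_^ n) (trans (cong (λ x → 2 ^ d * (x * (1 + d) ^ d)) (^-*-assoc 2 2 e)) (sym (*-assoc (2 ^ d) (2 ^ (2 * e)) _))) ⟩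
    (2 ^ d * 2 ^ (2 * e) * (1 + d) ^ d) ^ n      ≡⟨ cong (λ x → (x * (1 + d) ^ d) ^ n) (^-distribˡ-+-* 2 d (2 * e)) ⟨
    (2 ^ (d + 2 * e) * (1 + d) ^ d) ^ n          ≡⟨ ^-distribʳ-* (2 ^ (d + 2 * e)) ((1 + d) ^ d) n ⟩
    (2 ^ (d + 2 * e)) ^ n * ((1 + d) ^ d) ^ n    ≡⟨ cong₂ _*_ (trans (^-*-assoc 2 (d + 2 * e) n) (cong (2 ^_) (*-comm (d + 2 * e) n))) (^-swap (1 + d) d n) ⟩
    2 ^ (n * (d + 2 * e)) * ((1 + d) ^ n) ^ d    ∎)
    where
    open ≤-Reasoning
    i³ : ∀ i → i * (i * (i * 1)) ≡ i * i * i
    i³ = solve-∀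
    q⁴≢0 : NonZero ((q * q * (q * q)) ^ n)
    q⁴≢0 = m^n≢0 (q * q * (q * q)) n {{m*n≢0 (q * q) (q * q) {{m*n≢0 q q}} {{m*n≢0 q q}}}}
    lhs : cube (i * q ^ n) * (q + d * q) ^ n ≡ cube i * (1 + d) ^ n * (q * q * (q * q)) ^ n
    lhs = begin-equality
      cube (i * q ^ n) * ((1 + d) * q) ^ n              ≡⟨ cong (cube (i * q ^ n) *_) (^-distribʳ-* (1 + d) q n) ⟩
      cube (i * q ^ n) * ((1 + d) ^ n * q ^ n)          ≡⟨ r i (q ^ n) ((1 + d) ^ n) ⟩
      cube i * (1 + d) ^ n * (q ^ n * q ^ n * (q ^ n * q ^ n))
        ≡⟨ cong (cube i * (1 + d) ^ n *_) (trans (^-distribʳ-* (q * q) (q * q) n) (cong₂ _*_ (^-distribʳ-* q q n) (^-distribʳ-* q q n))) ⟨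
      cube i * (1 + d) ^ n * (q * q * (q * q)) ^ n      ∎
      where
      r : ∀ i t s → i * t * (i * t) * (i * t) * (s * t) ≡ i * i * i * s * (t * t * (t * t))
      r = solve-∀
    rhs : (q * q * ((q + q) * (q + (d + e) * q))) ^ n ≡ (2 * (e + (1 + d))) ^ n * (q * q * (q * q)) ^ n
    rhs = trans (cong (_^ n) (r q d e)) (^-distribʳ-* (2 * (e + (1 + d))) (q * q * (q * q)) n)
      where
      r : ∀ q d e → q * q * ((q + q) * (q + (d + e) * q)) ≡ 2 * (e + (1 + d)) * (q * q * (q * q))
      r = solve-∀
    reduced : cube i * (1 + d) ^ n ≤ (2 * (e + (1 + d))) ^ n
    reduced = *-cancelʳ-≤ _ _ ((q * q * (q * q)) ^ n) {{q⁴≢0}} (subst₂ _≤_ lhs rhs h)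

-- From powers of natural numbers to a rational bound

module Rationals where

  open import Data.Integer using (+_; -[1+_])
  import Data.Integer as ℤ
  import Data.Integer.Properties as ℤ
  open import Data.Nat using (suc; _+_; _*_; _^_; _≤_; NonZero)
  open import Data.Nat.Properties
  open import Data.Nat.Tactic.RingSolver using (solve-∀)
  import Data.Rational as ℚ
  open import Data.Rational using (ℚ; mkℚ)
  import Data.Rational.Properties as ℚ
  import Data.Rational.Unnormalised as ℚᵘ
  import Data.Rational.Unnormalised.Properties as ℚᵘ
  open import Relation.Binary.PropositionalEquality using (_≡_; sym; trans; cong; cong₂)
  open Inequalities using (^-swap)

  ^-cancelˡ-≤ : ∀ k {a b} .{{_ : NonZero k}} → a ^ k ≤ b ^ k → a ≤ b
  ^-cancelˡ-≤ k h = ≮⇒≥ λ b<a → <⇒≱ (^-monoˡ-< k b<a) h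

  -- The rational `r` is in lowest terms while A / B need not be. Raising to the power b and then
  -- cancelling the exponent `B` reconciles the two.
  log₂-fraction : ∀ (r : ℚ) i n A B .{{_ : NonZero B}} →
    ℚ.↥ r ℤ.* + B ≡ + A ℤ.* ℚ.↧ r → i ^ B ≤ 2 ^ (n * A) → log₂ i / n ≤ r
  log₂-fraction (mkℚ (+ a) b-1 _) i n A B eq h = ^-cancelˡ-≤ B (begin
    (i ^ b) ^ B            ≡⟨ ^-swap i b B ⟩
    (i ^ B) ^ b            ≤⟨ ^-monoˡ-≤ b h ⟩
    (2 ^ (n * A)) ^ b      ≡⟨ ^-*-assoc 2 (n * A) b ⟩
    2 ^ (n * A * b)        ≡⟨ cong (2 ^_) (trans (*-assoc n A b) (trans (cong (n *_) (sym aB≡Ab)) (sym (*-assoc n a B)))) ⟩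
    2 ^ (n * a * B)        ≡⟨ ^-*-assoc 2 (n * a) B ⟨
    (2 ^ (n * a)) ^ B      ∎)
    where
    open ≤-Reasoning
    b = suc b-1
    aB≡Ab : a * B ≡ A * b
    aB≡Ab = ℤ.+-injective (trans (ℤ.pos-* a B) (trans eq (sym (ℤ.pos-* A b))))
  -- A negative numerator times a positive `B` cannot equal the nonnegative product on the right, so
  -- `eq` is absurd.
  log₂-fraction (mkℚ -[1+ k ] b-1 _) i n A (suc B) eq h with trans eq (sym (ℤ.pos-* A (suc b-1)))
  ... | ()

  -- The sum is (d + 3 C) / (3 d), but normalisation hides these terms. It is therefore evaluated in
  -- unnormalised rationals, where the denominator computes to 3 * (1 * d).
  log₂-bound : ∀ C d i n .{{_ : NonZero d}} → i ^ (3 * d) ≤ 2 ^ (n * (d + 3 * C)) →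
    log₂ i / n ≤ + 1 ℚ./ 3 ℚ.+ + C ℚ./ 1 ℚ.* (+ 1 ℚ./ d)
  log₂-bound C (suc d-1) i n h = log₂-fraction r i n (d + 3 * C) (3 * d) (cross value) h
    where
    d = suc d-1
    r = + 1 ℚ./ 3 ℚ.+ + C ℚ./ 1 ℚ.* (+ 1 ℚ./ d)
    r′ = ℚᵘ.mkℚᵘ (+ 1) 2 ℚᵘ.+ ℚᵘ.mkℚᵘ (+ C) 0 ℚᵘ.* ℚᵘ.mkℚᵘ (+ 1) d-1
    value : ℚ.toℚᵘ r ℚᵘ.≃ r′
    value = ℚᵘ.≃-trans (ℚ.toℚᵘ-homo-+ (+ 1 ℚ./ 3) (+ C ℚ./ 1 ℚ.* (+ 1 ℚ./ d)))
      (ℚᵘ.+-cong (ℚ.toℚᵘ-fromℚᵘ (ℚᵘ.mkℚᵘ (+ 1) 2))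
        (ℚᵘ.≃-trans (ℚ.toℚᵘ-homo-* (+ C ℚ./ 1) (+ 1 ℚ./ d))
          (ℚᵘ.*-cong (ℚ.toℚᵘ-fromℚᵘ (ℚᵘ.mkℚᵘ (+ C) 0)) (ℚ.toℚᵘ-fromℚᵘ (ℚᵘ.mkℚᵘ (+ 1) d-1)))))
    cross : ℚ.toℚᵘ r ℚᵘ.≃ r′ → ℚ.↥ r ℤ.* + (3 * d) ≡ + (d + 3 * C) ℤ.* ℚ.↧ r
    cross e = trans (cong (λ x → ℚ.↥ r ℤ.* + (3 * x)) (sym (*-identityˡ d)))
      (trans (trans (cong (λ x → x ℤ.* + (3 * (1 * d))) (sym (ℚ.↥ᵘ-toℚᵘ r))) (ℚᵘ.drop-*≡* e))
        (cong₂ ℤ._*_ numerator (ℚ.↧ᵘ-toℚᵘ r)))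
      where
      numerator : ℚᵘ.↥ r′ ≡ + (d + 3 * C)
      numerator = trans (cong₂ ℤ._+_ (sym (ℤ.pos-* 1 (1 * d)))
                          (trans (cong (ℤ._* + 3) (sym (ℤ.pos-* C 1))) (sym (ℤ.pos-* (C * 1) 3))))
                        (cong +_ (eq C d))
        where
        eq : ∀ C d → 1 * (1 * d) + C * 1 * 3 ≡ d + 3 * C
        eq = solve-∀

-- Finite sums and weights of vertex sets

module FiniteSums where

  open import Data.Bool using (true; false; if_then_else_)
  open import Data.Empty using (⊥-elim)
  open import Data.Fin using (Fin; zero; suc; _≟_)
  open import Data.Fin.Subset using (Subset; inside; outside; _∈_; _∉_; ∣_∣)
  open import Data.Fin.Subset.Properties using (_∈?_; ⊆-antisym)
  open import Data.List using (List; []; _∷_; _++_; map; filter; length; allFin)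
  open import Data.List.Membership.Propositional using () renaming (_∈_ to _∈ₗ_)
  open import Data.List.Membership.Propositional.Properties using (∈-∃++; ∈-++⁺ˡ; ∈-++⁺ʳ; ∈-++⁻; ∈-filter⁺; ∈-filter⁻; ∈-allFin; ∈-map⁻)
  open import Data.List.Properties using (map-tabulate)
  open import Data.List.Relation.Unary.All as All using (All; []; _∷_)
  open import Data.List.Relation.Unary.AllPairs using ([]; _∷_)
  open import Data.List.Relation.Unary.Any using (here; there)
  open import Data.List.Relation.Unary.Unique.Propositional using (Unique)
  import Data.List.Relation.Unary.Unique.Propositional.Properties as Unique
  open import Data.Nat using (ℕ; zero; suc; _+_; _*_; _≤_; _<_; z≤n; s≤s)
  open import Data.Nat.Properties hiding (_≟_)
  open import Algebra.Properties.CommutativeSemigroup *-commutativeSemigroup using (x∙yz≈y∙xz)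
  open import Data.Nat.Tactic.RingSolver using (solve-∀)
  open import Data.Product using (_,_; proj₂)
  open import Data.Sum using (inj₁; inj₂)
  open import Data.Vec as Vec using (_[_]≔_)
  open import Data.Vec.Properties using ([]≔-updates; []≔-minimal; []=-injective)
  open import Function using (_∘_; id)
  open import Level using (Level)
  open import Relation.Binary using (DecidableEquality)
  open import Relation.Binary.PropositionalEquality using (_≡_; _≢_; refl; sym; trans; cong; cong₂; subst; module ≡-Reasoning)
  open import Relation.Nullary using (¬_; Dec; yes; no; does)
  open import Relation.Unary using (Pred; Decidable)

  private variable
    α β ℓ : Level
    A : Set α
    B : Set β

  -- The Iverson bracket, by which unnormalised probabilities become weighted sums.
  ⟦_⟧ : {P : Set ℓ} → Dec P → ℕ
  ⟦ P? ⟧ = if does P? then 1 else 0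

  ⟦⟧≡1 : {P : Set ℓ} (P? : Dec P) → P → ⟦ P? ⟧ ≡ 1
  ⟦⟧≡1 (yes _)  _  = refl
  ⟦⟧≡1 (no ¬pf) pf = ⊥-elim (¬pf pf)

  ⟦⟧≡0 : {P : Set ℓ} (P? : Dec P) → ¬ P → ⟦ P? ⟧ ≡ 0
  ⟦⟧≡0 (yes pf) ¬pf = ⊥-elim (¬pf pf)
  ⟦⟧≡0 (no _)   _   = refl

  ⟦⟧≤1 : {P : Set ℓ} (P? : Dec P) → ⟦ P? ⟧ ≤ 1
  ⟦⟧≤1 (yes _) = s≤s z≤n
  ⟦⟧≤1 (no _)  = z≤n

  ⟦⟧-mono : {P : Set ℓ} {Q : Set β} (P? : Dec P) (Q? : Dec Q) → (P → Q) → ⟦ P? ⟧ ≤ ⟦ Q? ⟧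
  ⟦⟧-mono (yes pf) Q? f = ≤-reflexive (sym (⟦⟧≡1 Q? (f pf)))
  ⟦⟧-mono (no _)   Q? f = z≤n

  ∑ : List A → (A → ℕ) → ℕ
  ∑ []       f = 0
  ∑ (x ∷ xs) f = f x + ∑ xs f

  ∑-mono : ∀ (xs : List A) {f g : A → ℕ} → (∀ {x} → x ∈ₗ xs → f x ≤ g x) → ∑ xs f ≤ ∑ xs g
  ∑-mono []       h = z≤n
  ∑-mono (x ∷ xs) h = +-mono-≤ (h (here refl)) (∑-mono xs (h ∘ there))

  ∑-cong : ∀ (xs : List A) {f g : A → ℕ} → (∀ {x} → x ∈ₗ xs → f x ≡ g x) → ∑ xs f ≡ ∑ xs g
  ∑-cong []       h = refl
  ∑-cong (x ∷ xs) h = cong₂ _+_ (h (here refl)) (∑-cong xs (h ∘ there))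

  ∑-distrib-+ : ∀ (xs : List A) (f g : A → ℕ) → ∑ xs (λ x → f x + g x) ≡ ∑ xs f + ∑ xs g
  ∑-distrib-+ []       f g = refl
  ∑-distrib-+ (x ∷ xs) f g = trans (cong (f x + g x +_) (∑-distrib-+ xs f g)) (r (f x) (g x) (∑ xs f) (∑ xs g))
    where
    r : ∀ a b c d → a + b + (c + d) ≡ a + c + (b + d)
    r = solve-∀

  *-distribˡ-∑ : ∀ k (xs : List A) (f : A → ℕ) → k * ∑ xs f ≡ ∑ xs (λ x → k * f x)
  *-distribˡ-∑ k []       f = *-zeroʳ k
  *-distribˡ-∑ k (x ∷ xs) f = trans (*-distribˡ-+ k (f x) (∑ xs f)) (cong (k * f x +_) (*-distribˡ-∑ k xs f))

  ∑-const : ∀ (xs : List A) k → ∑ xs (λ _ → k) ≡ length xs * k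
  ∑-const []       k = refl
  ∑-const (x ∷ xs) k = cong (k +_) (∑-const xs k)

  ∑-zero : ∀ (xs : List A) → ∑ xs (λ _ → 0) ≡ 0
  ∑-zero xs = trans (∑-const xs 0) (*-zeroʳ (length xs))

  ∑-swap : ∀ (xs : List A) (ys : List B) (f : A → B → ℕ) →
           ∑ xs (λ x → ∑ ys (f x)) ≡ ∑ ys (λ y → ∑ xs (λ x → f x y))
  ∑-swap []       ys f = sym (∑-zero ys)
  ∑-swap (x ∷ xs) ys f = trans (cong (∑ ys (f x) +_) (∑-swap xs ys f))
                               (sym (∑-distrib-+ ys (f x) (λ y → ∑ xs (λ x → f x y))))

  ∑-++ : ∀ (xs ys : List A) f → ∑ (xs ++ ys) f ≡ ∑ xs f + ∑ ys f
  ∑-++ []       ys f = refl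
  ∑-++ (x ∷ xs) ys f = trans (cong (f x +_) (∑-++ xs ys f)) (sym (+-assoc (f x) (∑ xs f) (∑ ys f)))

  ∑-map : ∀ (φ : A → B) xs f → ∑ (map φ xs) f ≡ ∑ xs (f ∘ φ)
  ∑-map φ []       f = refl
  ∑-map φ (x ∷ xs) f = cong (f (φ x) +_) (∑-map φ xs f)

  ∑-filter : ∀ {P : Pred A ℓ} (P? : Decidable P) xs f → ∑ (filter P? xs) f ≡ ∑ xs (λ x → ⟦ P? x ⟧ * f x)
  ∑-filter P? []       f = refl
  ∑-filter P? (x ∷ xs) f with does (P? x)
  ... | true  = cong₂ _+_ (sym (+-identityʳ (f x))) (∑-filter P? xs f)
  ... | false = ∑-filter P? xs f

  -- Since `xs` has no repetition, each of its entries can be struck from `ys` once, and what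
  -- remains of `ys` only adds natural numbers.
  ∑-⊆ : ∀ {xs ys : List A} f → Unique xs → (∀ {x} → x ∈ₗ xs → x ∈ₗ ys) → ∑ xs f ≤ ∑ ys f
  ∑-⊆ {xs = []} f _ _ = z≤n
  ∑-⊆ {xs = x ∷ xs} f (x∉ ∷ u) h with ∈-∃++ (h (here refl))
  ... | as , bs , refl = begin
    f x + ∑ xs f                ≤⟨ +-monoʳ-≤ (f x) (∑-⊆ f u sub) ⟩
    f x + ∑ (as ++ bs) f        ≡⟨ cong (f x +_) (∑-++ as bs f) ⟩
    f x + (∑ as f + ∑ bs f)     ≡⟨ r (f x) (∑ as f) (∑ bs f) ⟩
    ∑ as f + (f x + ∑ bs f)     ≡⟨ ∑-++ as (x ∷ bs) f ⟨
    ∑ (as ++ x ∷ bs) f          ∎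
    where
    open ≤-Reasoning
    r : ∀ a b c → a + (b + c) ≡ b + (a + c)
    r = solve-∀
    sub : ∀ {y} → y ∈ₗ xs → y ∈ₗ as ++ bs
    sub y∈ with ∈-++⁻ as (h (there y∈))
    ... | inj₁ y∈as         = ∈-++⁺ˡ y∈as
    ... | inj₂ (here refl)  = ⊥-elim (All.lookup x∉ y∈ refl)
    ... | inj₂ (there y∈bs) = ∈-++⁺ʳ as y∈bs

  unique-map : ∀ (φ : A → B) {xs} → (∀ {x y} → x ∈ₗ xs → y ∈ₗ xs → φ x ≡ φ y → x ≡ y) →
               Unique xs → Unique (map φ xs)
  unique-map φ inj []       = []
  unique-map φ {x ∷ xs} inj (x∉ ∷ u) =
    All.tabulate (λ {z} z∈ eq → let y , y∈ , z≡ = ∈-map⁻ φ z∈ in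
      All.lookup x∉ y∈ (inj (here refl) (there y∈) (trans eq z≡)))
    ∷ unique-map φ (λ x∈ y∈ → inj (there x∈) (there y∈)) u

  ∑-injection : ∀ {xs : List A} {ys : List B} {f g} (φ : A → B) → Unique xs →
    (∀ {x} → x ∈ₗ xs → φ x ∈ₗ ys) → (∀ {x y} → x ∈ₗ xs → y ∈ₗ xs → φ x ≡ φ y → x ≡ y) →
    (∀ {x} → x ∈ₗ xs → f x ≤ g (φ x)) → ∑ xs f ≤ ∑ ys g
  ∑-injection {xs = xs} {ys} {f} {g} φ u φ∈ inj h = begin
    ∑ xs f             ≤⟨ ∑-mono xs h ⟩
    ∑ xs (g ∘ φ)       ≡⟨ ∑-map φ xs g ⟨
    ∑ (map φ xs) g     ≤⟨ ∑-⊆ g (unique-map φ inj u) (λ z∈ → let y , y∈ , z≡ = ∈-map⁻ φ z∈ in subst (_∈ₗ ys) (sym z≡) (φ∈ y∈)) ⟩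
    ∑ ys g             ∎
    where open ≤-Reasoning

  module _ (_≟ᴮ_ : DecidableEquality B) where

    private
      ∑-point : ∀ {bs} b₀ → Unique bs → b₀ ∈ₗ bs → ∑ bs (λ b → ⟦ b₀ ≟ᴮ b ⟧) ≡ 1
      ∑-point {b ∷ bs} b₀ (b∉ ∷ u) (here refl) =
        cong₂ _+_ (⟦⟧≡1 (b₀ ≟ᴮ b₀) refl) (trans (∑-cong bs (λ {x} x∈ → ⟦⟧≡0 (b₀ ≟ᴮ x) (All.lookup b∉ x∈))) (∑-zero bs))
      ∑-point {b ∷ bs} b₀ (b∉ ∷ u) (there b₀∈) =
        cong₂ _+_ (⟦⟧≡0 (b₀ ≟ᴮ b) (All.lookup b∉ b₀∈ ∘ sym)) (∑-point b₀ u b₀∈)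

    -- The law of total probability: insert 1 as the sum of the brackets of φ x ≡ b over all `b`,
    -- then exchange the sums.
    ∑-fibres : ∀ {bs} → Unique bs → (∀ b → b ∈ₗ bs) → ∀ (φ : A → B) xs f →
               ∑ xs f ≡ ∑ bs (λ b → ∑ (filter (λ x → φ x ≟ᴮ b) xs) f)
    ∑-fibres {bs = bs} u all φ xs f = begin
      ∑ xs f                                             ≡⟨ ∑-cong xs (λ {x} _ → trans (sym (*-identityʳ (f x))) (cong (f x *_) (sym (∑-point (φ x) u (all (φ x)))))) ⟩
      ∑ xs (λ x → f x * ∑ bs (λ b → ⟦ φ x ≟ᴮ b ⟧))         ≡⟨ ∑-cong xs (λ {x} _ → *-distribˡ-∑ (f x) bs _) ⟩
      ∑ xs (λ x → ∑ bs (λ b → f x * ⟦ φ x ≟ᴮ b ⟧))         ≡⟨ ∑-swap xs bs _ ⟩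
      ∑ bs (λ b → ∑ xs (λ x → f x * ⟦ φ x ≟ᴮ b ⟧))         ≡⟨ ∑-cong bs (λ {b} _ → trans (∑-cong xs (λ {x} _ → *-comm (f x) _)) (sym (∑-filter (λ x → φ x ≟ᴮ b) xs f))) ⟩
      ∑ bs (λ b → ∑ (filter (λ x → φ x ≟ᴮ b) xs) f)        ∎
      where open ≡-Reasoning

  ∑-allFin-suc : ∀ {n} (f : Fin (suc n) → ℕ) → ∑ (allFin (suc n)) f ≡ f zero + ∑ (allFin n) (f ∘ suc)
  ∑-allFin-suc {n} f = cong (f zero +_) (trans (cong (λ xs → ∑ xs f) (sym (map-tabulate id suc))) (∑-map suc (allFin n) f))

  ∣∣≡∑ : ∀ {n} (p : Subset n) → ∣ p ∣ ≡ ∑ (allFin n) (λ v → ⟦ v ∈? p ⟧)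
  ∣∣≡∑ Vec.[] = refl
  ∣∣≡∑ {suc n} (inside Vec.∷ p)  = trans (cong suc (∣∣≡∑ p)) (sym (∑-allFin-suc (λ v → ⟦ v ∈? (inside Vec.∷ p) ⟧)))
  ∣∣≡∑ {suc n} (outside Vec.∷ p) = trans (∣∣≡∑ p) (sym (∑-allFin-suc (λ v → ⟦ v ∈? (outside Vec.∷ p) ⟧)))

  members : ∀ {n} → Subset n → List (Fin n)
  members p = filter (_∈? p) (allFin _)

  members-unique : ∀ {n} (p : Subset n) → Unique (members p)
  members-unique p = Unique.filter⁺ (_∈? p) (Unique.allFin⁺ _)

  ∈-members⁺ : ∀ {n} {p : Subset n} {v} → v ∈ p → v ∈ₗ members p
  ∈-members⁺ {p = p} {v} v∈ = ∈-filter⁺ (_∈? p) (∈-allFin v) v∈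

  ∈-members⁻ : ∀ {n} {p : Subset n} {v} → v ∈ₗ members p → v ∈ p
  ∈-members⁻ {p = p} v∈ = proj₂ (∈-filter⁻ (_∈? p) {xs = allFin _} v∈)

  length-∑ : ∀ (xs : List A) → length xs ≡ ∑ xs (λ _ → 1)
  length-∑ xs = sym (trans (∑-const xs 1) (*-identityʳ _))

  length-members : ∀ {n} (p : Subset n) → length (members p) ≡ ∣ p ∣
  length-members {n} p = trans (length-∑ (members p)) (trans (∑-filter (_∈? p) (allFin n) (λ _ → 1))
    (trans (∑-cong (allFin n) (λ _ → *-identityʳ _)) (sym (∣∣≡∑ p))))

  ∣∣<2⇒≡ : ∀ {n} {p : Subset n} → ∣ p ∣ < 2 → ∀ {u v} → u ∈ p → v ∈ p → u ≡ v
  ∣∣<2⇒≡ {p = p} lt {u} {v} u∈ v∈ with u ≟ v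
  ... | yes eq = eq
  ... | no u≢v = ⊥-elim (<⇒≱ lt (subst (2 ≤_) (length-members p) (subst (2 ≤_) (sym (length-∑ (members p)))
    (∑-⊆ {xs = u ∷ v ∷ []} (λ _ → 1) ((u≢v ∷ []) ∷ [] ∷ [])
      (λ { (here refl) → ∈-members⁺ u∈ ; (there (here refl)) → ∈-members⁺ v∈ })))))

  ≡⇒∣∣<2 : ∀ {n} {p : Subset n} → (∀ {u v} → u ∈ p → v ∈ p → u ≡ v) → ∣ p ∣ < 2
  ≡⇒∣∣<2 {p = p} h = subst (_< 2) (length-members p) (small (members p) (members-unique p) ∈-members⁻)
    where
    small : ∀ xs → Unique xs → (∀ {v} → v ∈ₗ xs → v ∈ p) → length xs < 2
    small [] _ _ = s≤s z≤n
    small (_ ∷ []) _ _ = s≤s (s≤s z≤n)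
    small (_ ∷ _ ∷ _) ((u≢v ∷ _) ∷ _) k = ⊥-elim (u≢v (h (k (here refl)) (k (there (here refl)))))

  infixl 6 _⊕_ _⊖_
  _⊕_ _⊖_ : ∀ {n} → Subset n → Fin n → Subset n
  I ⊕ x = I [ x ]≔ inside
  I ⊖ x = I [ x ]≔ outside

  x∈I⊕x : ∀ {n} (I : Subset n) x → x ∈ I ⊕ x
  x∈I⊕x I x = []≔-updates I x

  ∈-⊕⁺ : ∀ {n} {I : Subset n} {x v} → v ∈ I → v ∈ I ⊕ x
  ∈-⊕⁺ {I = I} {x} {v} v∈ with v ≟ x
  ... | yes refl = x∈I⊕x I x
  ... | no v≢x   = []≔-minimal I v x v≢x v∈

  ∈-⊖⁺ : ∀ {n} {I : Subset n} {x v} → v ≢ x → v ∈ I → v ∈ I ⊖ x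
  ∈-⊖⁺ {I = I} {x} {v} v≢x v∈ = []≔-minimal I v x v≢x v∈

  x∉I⊖x : ∀ {n} (I : Subset n) x → x ∉ I ⊖ x
  x∉I⊖x I x x∈ with () ← []=-injective x∈ ([]≔-updates I x)

  ∈-[]≔⁻ : ∀ {n} {I : Subset n} {x v s} → v ≢ x → v ∈ I [ x ]≔ s → v ∈ I
  ∈-[]≔⁻ {I = _ Vec.∷ _} {zero}  {zero}  v≢x _ = ⊥-elim (v≢x refl)
  ∈-[]≔⁻ {I = _ Vec.∷ _} {zero}  {suc v} v≢x (Vec.there h) = Vec.there h
  ∈-[]≔⁻ {I = _ Vec.∷ _} {suc x} {zero}  v≢x Vec.here = Vec.here
  ∈-[]≔⁻ {I = _ Vec.∷ _} {suc x} {suc v} v≢x (Vec.there h) = Vec.there (∈-[]≔⁻ (v≢x ∘ cong suc) h)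

  ∈-⊖⁻ : ∀ {n} {I : Subset n} {x v} → v ∈ I ⊖ x → v ∈ I
  ∈-⊖⁻ {I = I} {x} {v} h with v ≟ x
  ... | yes refl = ⊥-elim (x∉I⊖x I x h)
  ... | no v≢x   = ∈-[]≔⁻ v≢x h

  ⊖-⊕ : ∀ {n} {I : Subset n} {x} → x ∈ I → I ⊖ x ⊕ x ≡ I
  ⊖-⊕ {I = I} {x} x∈ = ⊆-antisym to from
    where
    to : ∀ {v} → v ∈ I ⊖ x ⊕ x → v ∈ I
    to {v} h with v ≟ x
    ... | yes refl = x∈
    ... | no v≢x   = ∈-⊖⁻ (∈-[]≔⁻ v≢x h)
    from : ∀ {v} → v ∈ I → v ∈ I ⊖ x ⊕ x
    from {v} h with v ≟ x
    ... | yes refl = x∈I⊕x (I ⊖ x) x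
    ... | no v≢x   = ∈-⊕⁺ (∈-⊖⁺ v≢x h)

  weight : ℕ → ℕ → ∀ {n} → Subset n → ℕ
  weight p q Vec.[]            = 1
  weight p q (inside  Vec.∷ I) = p * weight p q I
  weight p q (outside Vec.∷ I) = q * weight p q I

  weight-⊕ : ∀ p q {n} {I : Subset n} {x} → x ∉ I → q * weight p q (I ⊕ x) ≡ p * weight p q I
  weight-⊕ p q {I = inside  Vec.∷ I} {zero}  x∉ = ⊥-elim (x∉ Vec.here)
  weight-⊕ p q {I = outside Vec.∷ I} {zero}  x∉ = x∙yz≈y∙xz q p (weight p q I)
  weight-⊕ p q {I = inside  Vec.∷ I} {suc x} x∉ =
    trans (x∙yz≈y∙xz q p (weight p q (I ⊕ x))) (cong (p *_) (weight-⊕ p q (x∉ ∘ Vec.there)))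
  weight-⊕ p q {I = outside Vec.∷ I} {suc x} x∉ =
    trans (cong (q *_) (weight-⊕ p q (x∉ ∘ Vec.there))) (x∙yz≈y∙xz q p (weight p q I))

  weight-⊖ : ∀ p q {n} {I : Subset n} {x} → x ∈ I → q * weight p q I ≡ p * weight p q (I ⊖ x)
  weight-⊖ p q {I = I} {x} x∈ = trans (cong (λ J → q * weight p q J) (sym (⊖-⊕ x∈))) (weight-⊕ p q (x∉I⊖x I x))

  -- A discrete derivative in `p`: for k = |I| and up to a power of `q` it reads p^k - (p - 1)^k ≤ k
  -- p^(k - 1). Summed over the independent sets it bounds the growth of Z by the mean size.
  weight-step : ∀ p′ q {n} (I : Subset n) → let p = suc p′ in
    p * weight p q I ≤ p * weight p′ q I + ∣ I ∣ * weight p q I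
  weight-step p′ q Vec.[] = m≤m+n _ 0
  weight-step p′ q (outside Vec.∷ I) = begin
    p * (q * b)                      ≡⟨ x∙yz≈y∙xz p q b ⟩
    q * (p * b)                      ≤⟨ *-monoʳ-≤ q (weight-step p′ q I) ⟩
    q * (p * a + k * b)              ≡⟨ r′ q p a k b ⟩
    p * (q * a) + k * (q * b)        ∎
    where
    open ≤-Reasoning
    p = suc p′
    a = weight p′ q I
    b = weight p q I
    k = ∣ I ∣
    r′ : ∀ q p a k b → q * (p * a + k * b) ≡ p * (q * a) + k * (q * b)
    r′ = solve-∀
  weight-step p′ q (inside Vec.∷ I) = begin
    p * (p * b)                                  ≡⟨ r p′ b ⟩
    p′ * (p * b) + p * b                         ≤⟨ +-monoˡ-≤ (p * b) (*-monoʳ-≤ p′ (weight-step p′ q I)) ⟩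
    p′ * (p * a + k * b) + p * b                 ≤⟨ m≤m+n _ (k * b) ⟩
    p′ * (p * a + k * b) + p * b + k * b         ≡⟨ r′ p′ a k b ⟩
    p * (p′ * a) + suc k * (p * b)               ∎
    where
    open ≤-Reasoning
    p = suc p′
    a = weight p′ q I
    b = weight p q I
    k = ∣ I ∣
    r : ∀ p′ b → suc p′ * (suc p′ * b) ≡ p′ * (suc p′ * b) + suc p′ * b
    r = solve-∀
    r′ : ∀ p′ a k b → p′ * (suc p′ * a + k * b) + suc p′ * b + k * b ≡ suc p′ * (p′ * a) + suc k * (suc p′ * b)
    r′ = solve-∀

module Occupancy where

  open import Data.Bool using (if_then_else_)
  import Data.Bool.Properties as Bool
  open import Data.Empty using (⊥-elim)
  open import Data.Fin using (Fin; _≟_)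
  open import Data.Fin.Properties using (all?; any?)
  open import Data.Fin.Subset using (Subset; inside; outside; _∈_; _∉_; ∣_∣)
  open import Data.Fin.Subset.Properties using (_∈?_; ⊆-antisym; x∈p∩q⁺; x∈p∩q⁻)
  open import Data.List using (List; []; _∷_; _++_; map; filter; length; allFin)
  open import Data.List.Membership.Propositional using (find; lose) renaming (_∈_ to _∈ₗ_)
  open import Data.List.Membership.Propositional.Properties using (∈-++⁻; ∈-filter⁺; ∈-filter⁻; ∈-map⁻; ∈-map⁺)
  open import Data.List.Properties using (length-map; length-filter; length-tabulate; length-++)
  open import Data.List.Relation.Unary.All as All using (All; []; _∷_)
  open import Data.List.Relation.Unary.AllPairs using ([]; _∷_)
  open import Data.List.Relation.Unary.Any as Any using (here; there)
  open import Data.List.Relation.Unary.Unique.Propositional using (Unique)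
  import Data.List.Relation.Unary.Unique.Propositional.Properties as Unique
  open import Data.Nat using (ℕ; zero; suc; _+_; _*_; _^_; _≤_; z≤n; s≤s; NonZero; ≢-nonZero⁻¹; _≤?_)
  open import Data.Nat.Properties hiding (_≟_)
  open import Algebra.Properties.CommutativeSemigroup *-commutativeSemigroup using (x∙yz≈y∙xz)
  open import Data.Nat.Tactic.RingSolver using (solve-∀)
  open import Data.Product using (_,_; proj₁; proj₂; _×_; ∃-syntax)
  open import Data.Sum as Sum using (_⊎_; inj₁; inj₂)
  open import Data.Vec as Vec using ()
  open import Data.Vec.Properties using (lookup∘tabulate; []=⇒lookup; lookup⇒[]=; ≡-dec)
  open import Function using (_∘_; id)
  open import Relation.Binary using (DecidableEquality)
  open import Relation.Binary.PropositionalEquality using (_≡_; _≢_; refl; sym; trans; cong; cong₂; subst; module ≡-Reasoning)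
  open import Relation.Nullary using (¬_; Dec; yes; no; does)
  open import Relation.Nullary.Decidable using (map′; _×-dec_; _→-dec_; ¬?)
  open import Relation.Unary using (Decidable)
  open Inequalities
  open FiniteSums

  -- Extensions of a set by independent choices of vertices

  ⊕-injective : ∀ {n} {S S′ : Subset n} {y} → y ∉ S → y ∉ S′ → S ⊕ y ≡ S′ ⊕ y → S ≡ S′
  ⊕-injective {S = S} {S′} {y} y∉S y∉S′ eq = ⊆-antisym (half y∉S eq) (half y∉S′ (sym eq))
    where
    half : ∀ {S S′} → y ∉ S → S ⊕ y ≡ S′ ⊕ y → ∀ {v} → v ∈ S → v ∈ S′
    half y∉S eq {v} v∈ = ∈-[]≔⁻ (λ { refl → y∉S v∈ }) (subst (v ∈_) eq (∈-⊕⁺ v∈))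

  -- Supplies the family behind the term (1 + λ)^m: one selected vertex per open edge may be added
  -- to J or left out.
  adjoin : ∀ {n} → List (Fin n) → Subset n → List (Subset n)
  adjoin []       J = J ∷ []
  adjoin (y ∷ ys) J = adjoin ys J ++ map (_⊕ y) (adjoin ys J)

  module _ {n} {J : Subset n} where

    adjoin-⊇ : ∀ ys {S} → S ∈ₗ adjoin ys J → ∀ {v} → v ∈ J → v ∈ S
    adjoin-⊇ []       (here refl) v∈ = v∈
    adjoin-⊇ (y ∷ ys) S∈ v∈ with ∈-++⁻ (adjoin ys J) S∈
    ... | inj₁ S∈′ = adjoin-⊇ ys S∈′ v∈
    ... | inj₂ S∈′ with ∈-map⁻ (_⊕ y) S∈′
    ...   | S′ , S′∈ , refl = ∈-⊕⁺ (adjoin-⊇ ys S′∈ v∈)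

    ∈-adjoin⁻ : ∀ ys {S} → S ∈ₗ adjoin ys J → ∀ {v} → v ∈ S → v ∈ J ⊎ v ∈ₗ ys
    ∈-adjoin⁻ []       (here refl) v∈ = inj₁ v∈
    ∈-adjoin⁻ (y ∷ ys) S∈ {v} v∈ with ∈-++⁻ (adjoin ys J) S∈
    ... | inj₁ S∈′ = Sum.map₂ there (∈-adjoin⁻ ys S∈′ v∈)
    ... | inj₂ S∈′ with ∈-map⁻ (_⊕ y) S∈′ | v ≟ y
    ...   | S′ , S′∈ , refl | yes refl = inj₂ (here refl)
    ...   | S′ , S′∈ , refl | no v≢y   = Sum.map₂ there (∈-adjoin⁻ ys S′∈ (∈-[]≔⁻ v≢y v∈))

    ∉-adjoin : ∀ ys {S y} → y ∉ J → ¬ y ∈ₗ ys → S ∈ₗ adjoin ys J → y ∉ S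
    ∉-adjoin ys y∉J y∉ys S∈ y∈S with ∈-adjoin⁻ ys S∈ y∈S
    ... | inj₁ y∈J  = y∉J y∈J
    ... | inj₂ y∈ys = y∉ys y∈ys

    adjoin-unique : ∀ {ys} → Unique ys → (∀ {y} → y ∈ₗ ys → y ∉ J) → Unique (adjoin ys J)
    adjoin-unique []            _  = [] ∷ []
    adjoin-unique {y ∷ ys} (y∉ ∷ u) ∉J = Unique.++⁺ (adjoin-unique u (∉J ∘ there))
      (unique-map (_⊕ y) (λ S∈ S′∈ → ⊕-injective (fresh S∈) (fresh S′∈)) (adjoin-unique u (∉J ∘ there)))
      λ { (S∈ , S∈′) → let S′ , _ , S≡ = ∈-map⁻ (_⊕ y) S∈′ in
          fresh S∈ (subst (y ∈_) (sym S≡) (x∈I⊕x S′ y)) }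
      where
      fresh : ∀ {S} → S ∈ₗ adjoin ys J → y ∉ S
      fresh = ∉-adjoin ys (∉J (here refl)) (λ y∈ → All.lookup y∉ y∈ refl)

    -- Each vertex is new to all sets built before it, so admitting it multiplies the total by 1 +
    -- λ. The powers of `q` clear denominators.
    ∑-adjoin : ∀ p q {ys} → Unique ys → (∀ {y} → y ∈ₗ ys → y ∉ J) →
      q ^ length ys * ∑ (adjoin ys J) (weight p q) ≡ (q + p) ^ length ys * weight p q J
    ∑-adjoin p q []            _  = cong (1 *_) (+-identityʳ (weight p q J))
    ∑-adjoin p q {y ∷ ys} (y∉ ∷ u) ∉J = begin
      q * q ^ l * ∑ (adjoin ys J ++ map (_⊕ y) (adjoin ys J)) w
        ≡⟨ cong (q * q ^ l *_) (trans (∑-++ (adjoin ys J) _ w) (cong (s +_) (∑-map (_⊕ y) (adjoin ys J) w))) ⟩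
      q * q ^ l * (s + ∑ (adjoin ys J) (λ S → w (S ⊕ y)))
        ≡⟨ r₁ q (q ^ l) s _ ⟩
      q ^ l * (q * s + q * ∑ (adjoin ys J) (λ S → w (S ⊕ y)))
        ≡⟨ cong (λ x → q ^ l * (q * s + x)) (trans (*-distribˡ-∑ q (adjoin ys J) _)
             (trans (∑-cong (adjoin ys J) (λ S∈ → weight-⊕ p q (fresh S∈))) (sym (*-distribˡ-∑ p (adjoin ys J) w)))) ⟩
      q ^ l * (q * s + p * s)
        ≡⟨ r₂ q p (q ^ l) s ⟩
      (q + p) * (q ^ l * s)
        ≡⟨ cong ((q + p) *_) (∑-adjoin p q u (∉J ∘ there)) ⟩
      (q + p) * ((q + p) ^ l * w J)
        ≡⟨ *-assoc (q + p) ((q + p) ^ l) (w J) ⟨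
      (q + p) * (q + p) ^ l * w J ∎
      where
      open ≡-Reasoning
      w : Subset n → ℕ
      w = weight p q
      l = length ys
      s = ∑ (adjoin ys J) w
      fresh : ∀ {S} → S ∈ₗ adjoin ys J → y ∉ S
      fresh = ∉-adjoin ys (∉J (here refl)) (λ y∈ → All.lookup y∉ y∈ refl)
      r₁ : ∀ q t s z → q * t * (s + z) ≡ t * (q * s + q * z)
      r₁ = solve-∀
      r₂ : ∀ q p t s → t * (q * s + p * s) ≡ (q + p) * (t * s)
      r₂ = solve-∀

  -- Adjacency, free vertices and open edges

  module Neighbourhoods {n} (G : Hypergraph n) where

    infix 4 _~_ _~?_
    -- Unlike `Neighbors` this allows u = v, so a vertex in some edge is related to itself and
    -- `far x` removes `x` as well.
    _~_ : Fin n → Fin n → Set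
    u ~ v = ∃[ e ] (e ∈ₗ edges G × u ∈ e × v ∈ e)

    _~?_ : ∀ u v → Dec (u ~ v)
    u ~? v = map′ find (λ (_ , e∈ , h) → lose e∈ h) (Any.any? (λ e → (u ∈? e) ×-dec (v ∈? e)) (edges G))

    ~-sym : ∀ {u v} → u ~ v → v ~ u
    ~-sym (e , e∈ , u∈ , v∈) = e , e∈ , v∈ , u∈

    Strong : Subset n → Set
    Strong I = ∀ {u v} → u ~ v → u ∈ I → v ∈ I → u ≡ v

    strong⁺ : ∀ {I} → StrongIndependent G I → Strong I
    strong⁺ {I} h (e , e∈ , u∈e , v∈e) u∈I v∈I =
      ∣∣<2⇒≡ (All.lookup h e∈) (x∈p∩q⁺ (u∈I , u∈e)) (x∈p∩q⁺ (v∈I , v∈e))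

    strong⁻ : ∀ {I} → Strong I → StrongIndependent G I
    strong⁻ {I} h = All.tabulate λ {e} e∈ → ≡⇒∣∣<2 λ u∈ v∈ →
      let u∈I , u∈e = x∈p∩q⁻ I e u∈; v∈I , v∈e = x∈p∩q⁻ I e v∈ in h (e , e∈ , u∈e , v∈e) u∈I v∈I

    sets : List (Subset n)
    sets = filter (strongIndependent? G) (subsets n)

    sets-unique : Unique sets
    sets-unique = Unique.filter⁺ (strongIndependent? G) (subsets-unique n)

    ∈-sets⁺ : ∀ {I} → Strong I → I ∈ₗ sets
    ∈-sets⁺ {I} h = ∈-filter⁺ (strongIndependent? G) (∈-subsets I) (strong⁻ h)

    ∈-sets⁻ : ∀ {I} → I ∈ₗ sets → Strong I
    ∈-sets⁻ I∈ = strong⁺ (proj₂ (∈-filter⁻ (strongIndependent? G) {xs = subsets n} I∈))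

    far : Fin n → Subset n → Subset n
    far x I = Vec.tabulate λ v → if does (v ~? x) then outside else Vec.lookup I v

    ∈-far⁺ : ∀ {x I v} → v ∈ I → ¬ v ~ x → v ∈ far x I
    ∈-far⁺ {x} {I} {v} v∈ v≁x = lookup⇒[]= v (far x I) (trans (lookup∘tabulate _ v) (value (v ~? x)))
      where
      value : (v~x? : Dec (v ~ x)) → (if does v~x? then outside else Vec.lookup I v) ≡ inside
      value (yes v~x) = ⊥-elim (v≁x v~x)
      value (no _)    = []=⇒lookup v∈

    ∈-far⁻ : ∀ {x I v} → v ∈ far x I → v ∈ I × ¬ v ~ x
    ∈-far⁻ {x} {I} {v} v∈ = analyse (v ~? x) (trans (sym (lookup∘tabulate _ v)) ([]=⇒lookup v∈))
      where
      analyse : (v~x? : Dec (v ~ x)) → (if does v~x? then outside else Vec.lookup I v) ≡ inside → v ∈ I × ¬ v ~ x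
      analyse (yes _)  ()
      analyse (no v≁x) eq = lookup⇒[]= v I eq , v≁x

    far-≡ : ∀ {x J I} → (∀ {v} → v ∈ J → ¬ v ~ x) → (∀ {v} → v ∈ J → v ∈ I) →
            (∀ {v} → v ∈ I → v ∈ J ⊎ v ~ x) → far x I ≡ J
    far-≡ {x} {J} {I} J≁ J⊆I I⊆ = ⊆-antisym to (λ v∈ → ∈-far⁺ (J⊆I v∈) (J≁ v∈))
      where
      to : ∀ {v} → v ∈ far x I → v ∈ J
      to v∈ with ∈-far⁻ v∈
      ... | v∈I , v≁x with I⊆ v∈I
      ...   | inj₁ v∈J = v∈J
      ...   | inj₂ v~x = ⊥-elim (v≁x v~x)

    star : Fin n → List (Subset n)
    star x = filter (x ∈?_) (edges G)

    ∈-star⁻ : ∀ {x e} → e ∈ₗ star x → e ∈ₗ edges G × x ∈ e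
    ∈-star⁻ {x} = ∈-filter⁻ (x ∈?_)

    star-unique : ∀ x → Unique (star x)
    star-unique x = Unique.filter⁺ (x ∈?_) (unique G)

    Free : Subset n → Fin n → Subset n → Set
    Free I w e = ∀ u → u ∈ I → u ~ w → u ∈ e

    free? : ∀ I w e → Dec (Free I w e)
    free? I w e = all? λ u → (u ∈? I) →-dec (u ~? w) →-dec (u ∈? e)

    Open : Subset n → Fin n → Subset n → Set
    Open I x e = ∃[ w ] (w ≢ x × w ∈ e × Free I w e)

    open? : ∀ I x e → Dec (Open I x e)
    open? I x e = any? λ w → ¬? (w ≟ x) ×-dec (w ∈? e) ×-dec free? I w e

    -- Occupation of `x` itself does not cover it; this is why the event has weight 1 + λ.
    Uncovered : Subset n → Fin n → Set
    Uncovered I x = ∀ u → u ∈ I → u ~ x → u ≡ x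

    uncovered? : ∀ I x → Dec (Uncovered I x)
    uncovered? I x = all? λ u → (u ∈? I) →-dec (u ~? x) →-dec (u ≟ x)

    openEdges : Subset n → Fin n → ℕ
    openEdges I x = ∑ (star x) λ e → ⟦ open? I x e ⟧

    freeOpenEdges : Subset n → Fin n → ℕ
    freeOpenEdges I x = ∑ (star x) λ e → ⟦ open? I x e ⟧ * ⟦ free? I x e ⟧

    -- Double counting of incident vertex-edge pairs.
    ∑-incidences : ∀ (g : Fin n → Subset n → ℕ) →
      ∑ (allFin n) (λ x → ∑ (star x) (g x)) ≡ ∑ (edges G) (λ e → ∑ (members e) (λ x → g x e))
    ∑-incidences g = begin
      ∑ (allFin n) (λ x → ∑ (star x) (g x))
        ≡⟨ ∑-cong (allFin n) (λ {x} _ → ∑-filter (x ∈?_) (edges G) (g x)) ⟩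
      ∑ (allFin n) (λ x → ∑ (edges G) (λ e → ⟦ x ∈? e ⟧ * g x e))
        ≡⟨ ∑-swap (allFin n) (edges G) _ ⟩
      ∑ (edges G) (λ e → ∑ (allFin n) (λ x → ⟦ x ∈? e ⟧ * g x e))
        ≡⟨ ∑-cong (edges G) (λ {e} _ → sym (∑-filter (_∈? e) (allFin n) (λ x → g x e))) ⟩
      ∑ (edges G) (λ e → ∑ (members e) (λ x → g x e)) ∎
      where open ≡-Reasoning

    -- Only the free vertices of the edge matter: uncovered vertices are free in it, and openness at
    -- `x` asks for a free vertex other than `x`.
    edge-inequality : ∀ I e → ∣ e ∣ ≡ 3 → e ∈ₗ edges G →
      ∑ (members e) (λ x → 2 * ⟦ uncovered? I x ⟧) ≤
      ∑ (members e) (λ x → ⟦ open? I x e ⟧ + ⟦ open? I x e ⟧ * ⟦ free? I x e ⟧)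
    edge-inequality I e ∣e∣≡3 e∈ =
      on-triple (members e) (trans (length-members e) ∣e∣≡3) (members-unique e) ∈-members⁻
      where
      U F T : Fin n → ℕ
      U x = ⟦ uncovered? I x ⟧
      F x = ⟦ free? I x e ⟧
      T x = ⟦ open? I x e ⟧
      U≤F : ∀ {x} → x ∈ e → U x ≤ F x
      U≤F {x} x∈ = ⟦⟧-mono (uncovered? I x) (free? I x e) λ h u u∈ u~x → subst (_∈ e) (sym (h u u∈ u~x)) x∈
      F≤T : ∀ {x w} → w ≢ x → w ∈ e → F w ≤ T x
      F≤T {x} {w} w≢x w∈ = ⟦⟧-mono (free? I w e) (open? I x e) λ h → w , w≢x , w∈ , h
      F≤1 : ∀ x → F x ≤ 1
      F≤1 x = ⟦⟧≤1 (free? I x e)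
      -- With k free vertices in the edge the two sides compare as 2 ≤ 2, 4 ≤ 5
      -- and 6 ≤ 6 for k = 1, 2, 3.
      numeric : ∀ {u v w a b c r s t} → u ≤ a → v ≤ b → w ≤ c → a ≤ 1 → b ≤ 1 → c ≤ 1 →
        b ≤ r → c ≤ r → a ≤ s → c ≤ s → a ≤ t → b ≤ t →
        2 * u + (2 * v + (2 * w + 0)) ≤ (r + r * a) + ((s + s * b) + ((t + t * c) + 0))
      numeric {a = a} {b} {c} {r} {s} {t} u≤a v≤b w≤c a≤1 b≤1 c≤1 b≤r c≤r a≤s c≤s a≤t b≤t =
        ≤-trans (+-mono-≤ (*-monoʳ-≤ 2 u≤a) (+-mono-≤ (*-monoʳ-≤ 2 v≤b) (+-monoˡ-≤ 0 (*-monoʳ-≤ 2 w≤c))))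
          (bits r s t a≤1 b≤1 c≤1 b≤r c≤r a≤s c≤s a≤t b≤t)
        where
        rhs : ℕ → ℕ → ℕ → ℕ → ℕ → ℕ → ℕ
        rhs a b c r s t = (r + r * a) + ((s + s * b) + ((t + t * c) + 0))
        above : ∀ a b c r₀ s₀ t₀ r s t → r₀ ≤ r → s₀ ≤ s → t₀ ≤ t → rhs a b c r₀ s₀ t₀ ≤ rhs a b c r s t
        above a b c _ _ _ _ _ _ r≤ s≤ t≤ = +-mono-≤ (+-mono-≤ r≤ (*-monoˡ-≤ a r≤))
          (+-mono-≤ (+-mono-≤ s≤ (*-monoˡ-≤ b s≤)) (+-monoˡ-≤ 0 (+-mono-≤ t≤ (*-monoˡ-≤ c t≤))))
        -- Each clause fixes the three bits and with them the least possible `r`, `s`, `t`. The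
        -- numerals are compared by computation and `above` lifts the result to the actual values.
        bits : ∀ {a b c} r s t → a ≤ 1 → b ≤ 1 → c ≤ 1 → b ≤ r → c ≤ r → a ≤ s → c ≤ s → a ≤ t → b ≤ t →
          2 * a + (2 * b + (2 * c + 0)) ≤ rhs a b c r s t
        bits _ _ _ z≤n       z≤n       z≤n       _   _   _   _   _   _   = z≤n
        bits r s t z≤n       z≤n       (s≤s z≤n) _   c≤r _   c≤s _   _   = ≤-trans (≤ᵇ⇒≤ 2 2 _) (above 0 0 1 1 1 0 r s t c≤r c≤s z≤n)
        bits r s t z≤n       (s≤s z≤n) z≤n       b≤r _   _   _   _   b≤t = ≤-trans (≤ᵇ⇒≤ 2 2 _) (above 0 1 0 1 0 1 r s t b≤r z≤n b≤t)
        bits r s t z≤n       (s≤s z≤n) (s≤s z≤n) b≤r _   _   c≤s _   b≤t = ≤-trans (≤ᵇ⇒≤ 4 5 _) (above 0 1 1 1 1 1 r s t b≤r c≤s b≤t)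
        bits r s t (s≤s z≤n) z≤n       z≤n       _   _   a≤s _   a≤t _   = ≤-trans (≤ᵇ⇒≤ 2 2 _) (above 1 0 0 0 1 1 r s t z≤n a≤s a≤t)
        bits r s t (s≤s z≤n) z≤n       (s≤s z≤n) _   c≤r a≤s _   a≤t _   = ≤-trans (≤ᵇ⇒≤ 4 5 _) (above 1 0 1 1 1 1 r s t c≤r a≤s a≤t)
        bits r s t (s≤s z≤n) (s≤s z≤n) z≤n       b≤r _   a≤s _   a≤t _   = ≤-trans (≤ᵇ⇒≤ 4 5 _) (above 1 1 0 1 1 1 r s t b≤r a≤s a≤t)
        bits r s t (s≤s z≤n) (s≤s z≤n) (s≤s z≤n) b≤r _   a≤s _   a≤t _   = ≤-trans (≤ᵇ⇒≤ 6 6 _) (above 1 1 1 1 1 1 r s t b≤r a≤s a≤t)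
      on-triple : ∀ xs → length xs ≡ 3 → Unique xs → (∀ {v} → v ∈ₗ xs → v ∈ e) →
        ∑ xs (λ x → 2 * U x) ≤ ∑ xs (λ x → T x + T x * F x)
      on-triple (x ∷ y ∷ z ∷ []) _ ((x≢y ∷ x≢z ∷ []) ∷ (y≢z ∷ []) ∷ [] ∷ []) m =
        numeric (U≤F x∈) (U≤F y∈) (U≤F z∈) (F≤1 x) (F≤1 y) (F≤1 z)
          (F≤T (x≢y ∘ sym) y∈) (F≤T (x≢z ∘ sym) z∈) (F≤T x≢y x∈) (F≤T (y≢z ∘ sym) z∈) (F≤T x≢z x∈) (F≤T y≢z y∈)
        where
        x∈ = m (here refl)
        y∈ = m (there (here refl))
        z∈ = m (there (there (here refl)))

  -- The hard-core model at a fixed fugacity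

  module HardCore {n} (G : Hypergraph n) (d : ℕ) .{{d≢0 : NonZero d}}
    (uniform : Uniform G 3) (regular : Regular G d) (linear : Linear G) (crossFree : CrossEdgeFree G)
    (p q : ℕ) {{q≢0 : NonZero q}} (p≤q : p ≤ q) where

    open Neighbourhoods G

    w : Subset n → ℕ
    w = weight p q

    length-star : ∀ x → length (star x) ≡ d
    length-star = regular

    ~-refl : ∀ x → x ~ x
    ~-refl x with star x | length-star x | ∈-star⁻ {x}
    ... | []    | 0≡d | _  = ⊥-elim (≢-nonZero⁻¹ d (sym 0≡d))
    ... | e ∷ _ | _   | ∈⁻ = let e∈ , x∈e = ∈⁻ (here refl) in e , e∈ , x∈e , x∈e

    -- If `x` were outside `f`, then `u` and `v` would differ from it and be true neighbours, making
    -- `f` a cross-edge.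
    triangle : ∀ {x u v f} → u ~ x → v ~ x → f ∈ₗ edges G → u ∈ f → v ∈ f → u ≢ v → x ∈ f
    triangle {x} {u} {v} {f} u~x v~x f∈ u∈f v∈f u≢v with x ∈? f
    ... | yes x∈f = x∈f
    ... | no x∉f  = ⊥-elim (crossFree x f (f∈ , x∉f , u , v , u≢v ,
            ((λ { refl → x∉f u∈f }) , ~-sym u~x) , ((λ { refl → x∉f v∈f }) , ~-sym v~x) , u∈f , v∈f))

    -- By `triangle` the edge through `u` and `y` also contains `x`, so linearity identifies it with
    -- `e`. Thus a vertex near `x` cannot block `y` from outside `e`.
    common-edge : ∀ {x y u e} → e ∈ₗ edges G → x ∈ e → y ∈ e → y ≢ x → u ~ x → u ~ y → u ∈ e
    common-edge {x} {y} {u} {e} e∈ x∈e y∈e y≢x u~x (f , f∈ , u∈f , y∈f) with u ≟ y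
    ... | yes refl = y∈e
    ... | no u≢y   = subst (u ∈_) (linear y≢x f∈ y∈f x∈f e∈ y∈e x∈e) u∈f
      where
      x∈f : x ∈ f
      x∈f = triangle u~x (e , e∈ , y∈e , x∈e) f∈ u∈f y∈f u≢y

    _≟ˢ_ : DecidableEquality (Subset n)
    _≟ˢ_ = ≡-dec Bool._≟_

    class : Fin n → Subset n → List (Subset n)
    class x J = filter (λ I → far x I ≟ˢ J) sets

    -- The model conditioned on the far part J. The member `I₀` witnesses that the class is
    -- inhabited, and J inherits independence from it.
    module Class (x : Fin n) (I₀ : Subset n) (I₀∈ : I₀ ∈ₗ sets) where

      J : Subset n
      J = far x I₀

      cls : List (Subset n)
      cls = class x J

      J≁x : ∀ {v} → v ∈ J → ¬ v ~ x
      J≁x v∈ = proj₂ (∈-far⁻ {I = I₀} v∈)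

      x∉J : x ∉ J
      x∉J x∈ = J≁x x∈ (~-refl x)

      J-strong : Strong J
      J-strong u~v u∈ v∈ = ∈-sets⁻ I₀∈ u~v (proj₁ (∈-far⁻ u∈)) (proj₁ (∈-far⁻ v∈))

      ∈-cls⁻ : ∀ {I} → I ∈ₗ cls → Strong I × far x I ≡ J
      ∈-cls⁻ I∈ = let I∈sets , eq = ∈-filter⁻ (λ I → far x I ≟ˢ J) I∈ in ∈-sets⁻ I∈sets , eq

      ∈-cls⁺ : ∀ {I} → Strong I → far x I ≡ J → I ∈ₗ cls
      ∈-cls⁺ strong eq = ∈-filter⁺ (λ I → far x I ≟ˢ J) (∈-sets⁺ strong) eq

      cls-unique : Unique cls
      cls-unique = Unique.filter⁺ (λ I → far x I ≟ˢ J) sets-unique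

      J⊆ : ∀ {I} → I ∈ₗ cls → ∀ {v} → v ∈ J → v ∈ I
      J⊆ {I} I∈ {v} v∈ = proj₁ (∈-far⁻ (subst (v ∈_) (sym (proj₂ (∈-cls⁻ I∈))) v∈))

      ∈J : ∀ {I} → I ∈ₗ cls → ∀ {v} → v ∈ I → ¬ v ~ x → v ∈ J
      ∈J {I} I∈ {v} v∈ v≁x = subst (v ∈_) (proj₂ (∈-cls⁻ I∈)) (∈-far⁺ v∈ v≁x)

      -- A vertex of `I` near both `x` and the free vertex lies in `e` by `common-edge`. Only far
      -- vertices could block, and all of these belong to J, so the set of open edges is constant on
      -- the class.
      open⁺ : ∀ {I e} → I ∈ₗ cls → e ∈ₗ star x → Open J x e → Open I x e
      open⁺ {I} {e} I∈ e∈ (y , y≢x , y∈e , free) = y , y≢x , y∈e , free′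
        where
        free′ : Free I y e
        free′ u u∈I u~y with u ~? x
        ... | yes u~x = let e∈E , x∈e = ∈-star⁻ e∈ in common-edge e∈E x∈e y∈e y≢x u~x u~y
        ... | no u≁x  = free u (∈J I∈ u∈I u≁x) u~y

      open⁻ : ∀ {I e} → I ∈ₗ cls → Open I x e → Open J x e
      open⁻ I∈ (y , y≢x , y∈e , free) = y , y≢x , y∈e , λ u u∈J → free u (J⊆ I∈ u∈J)

      ⟦open⟧ : ∀ {I e} → I ∈ₗ cls → e ∈ₗ star x → ⟦ open? I x e ⟧ ≡ ⟦ open? J x e ⟧
      ⟦open⟧ {I} {e} I∈ e∈ = ≤-antisym (⟦⟧-mono (open? I x e) (open? J x e) (open⁻ I∈))
                                       (⟦⟧-mono (open? J x e) (open? I x e) (open⁺ I∈ e∈))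

      opens : List (Subset n)
      opens = filter (open? J x) (star x)

      m : ℕ
      m = length opens

      m≤d : m ≤ d
      m≤d = ≤-trans (length-filter (open? J x) (star x)) (≤-reflexive (length-star x))

      openEdges≡m : ∀ {I} → I ∈ₗ cls → openEdges I x ≡ m
      openEdges≡m {I} I∈ = trans (∑-cong (star x) (λ e∈ → trans (⟦open⟧ I∈ e∈) (sym (*-identityʳ _))))
        (trans (sym (∑-filter (open? J x) (star x) (λ _ → 1))) (sym (length-∑ opens)))

      choice : ∀ {e} → Dec (Open J x e) → Fin n
      choice (yes (y , _)) = y
      -- A placeholder that never arises on `opens`: by `∈-opens⁻` the vertex chosen there differs
      -- from `x`.
      choice (no _)        = x

      chosen : Subset n → Fin n
      chosen e = choice (open? J x e)

      ∈-opens⁻ : ∀ {e} → e ∈ₗ opens → e ∈ₗ edges G × x ∈ e × chosen e ≢ x × chosen e ∈ e × Free J (chosen e) e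
      ∈-opens⁻ {e} e∈ with ∈-filter⁻ (open? J x) e∈
      ... | e∈star , isOpen with ∈-star⁻ e∈star
      ...   | e∈E , x∈e = e∈E , x∈e , spec (open? J x e)
        where
        spec : (D : Dec (Open J x e)) → choice D ≢ x × choice D ∈ e × Free J (choice D) e
        spec (yes (_ , s)) = s
        spec (no ¬open)    = ⊥-elim (¬open isOpen)

      chosen-injective : ∀ {e f} → e ∈ₗ opens → f ∈ₗ opens → chosen e ≡ chosen f → e ≡ f
      chosen-injective {e} {f} e∈ f∈ eq =
        let e∈E , x∈e , ≢x , y∈e , _ = ∈-opens⁻ e∈
            f∈E , x∈f , _  , y∈f , _ = ∈-opens⁻ f∈
        in linear ≢x e∈E y∈e x∈e f∈E (subst (_∈ f) (sym eq) y∈f) x∈f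

      ys : List (Fin n)
      ys = map chosen opens

      ys-unique : Unique ys
      ys-unique = unique-map chosen chosen-injective (Unique.filter⁺ (open? J x) (star-unique x))

      ys~x : ∀ {y} → y ∈ₗ ys → y ~ x
      ys~x y∈ with ∈-map⁻ chosen y∈
      ... | e , e∈ , refl = let e∈E , x∈e , _ , y∈e , _ = ∈-opens⁻ e∈ in e , e∈E , y∈e , x∈e

      x∉ys : ¬ x ∈ₗ ys
      x∉ys x∈ with ∈-map⁻ chosen x∈
      ... | e , e∈ , x≡ = let _ , _ , ≢x , _ = ∈-opens⁻ e∈ in ≢x (sym x≡)

      -- Freeness would put such a vertex of J into `e`, next to `x`, which J avoids.
      J≁ys : ∀ {u y} → u ∈ J → y ∈ₗ ys → ¬ u ~ y
      J≁ys {u} u∈ y∈ u~y with ∈-map⁻ chosen y∈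
      ... | e , e∈ , refl = let e∈E , x∈e , _ , _ , free = ∈-opens⁻ e∈ in
        J≁x u∈ (e , e∈E , free u u∈ u~y , x∈e)

      -- An edge through two chosen vertices contains `x` by `triangle`, so by linearity it is the
      -- open edge of each; but an open edge has a single chosen vertex.
      ys-strong : ∀ {u v} → u ~ v → u ∈ₗ ys → v ∈ₗ ys → u ≡ v
      ys-strong {u} {v} u~v@(f , f∈ , u∈f , v∈f) u∈ v∈ with u ≟ v | ∈-map⁻ chosen u∈ | ∈-map⁻ chosen v∈
      ... | yes u≡v | _ | _ = u≡v
      ... | no u≢v  | e , e∈ , refl | e′ , e′∈ , refl =
        let e∈E , x∈e , ≢x , y∈e , _ = ∈-opens⁻ e∈
            e′∈E , x∈e′ , ≢x′ , y∈e′ , _ = ∈-opens⁻ e′∈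
            x∈f = triangle (ys~x u∈) (ys~x v∈) f∈ u∈f v∈f u≢v
        in cong chosen (trans (linear ≢x e∈E y∈e x∈e f∈ u∈f x∈f) (linear ≢x′ f∈ v∈f x∈f e′∈E y∈e′ x∈e′))

      adjoin∈cls : ∀ {S} → S ∈ₗ adjoin ys J → S ∈ₗ cls
      adjoin∈cls {S} S∈ = ∈-cls⁺ strong (far-≡ J≁x (adjoin-⊇ ys S∈) (λ v∈ → Sum.map₂ ys~x (∈-adjoin⁻ ys S∈ v∈)))
        where
        strong : Strong S
        strong {u} {v} u~v u∈ v∈ with ∈-adjoin⁻ ys S∈ u∈ | ∈-adjoin⁻ ys S∈ v∈
        ... | inj₁ u∈J  | inj₁ v∈J  = J-strong u~v u∈J v∈J
        ... | inj₁ u∈J  | inj₂ v∈ys = ⊥-elim (J≁ys u∈J v∈ys u~v)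
        ... | inj₂ u∈ys | inj₁ v∈J  = ⊥-elim (J≁ys v∈J u∈ys (~-sym u~v))
        ... | inj₂ u∈ys | inj₂ v∈ys = ys-strong u~v u∈ys v∈ys

      ∈-⊕⁻ : ∀ {v y} → v ∈ J ⊕ y → v ≡ y ⊎ v ∈ J
      ∈-⊕⁻ {v} {y} v∈ with v ≟ y
      ... | yes v≡y = inj₁ v≡y
      ... | no v≢y  = inj₂ (∈-[]≔⁻ v≢y v∈)

      J⊕x∈cls : J ⊕ x ∈ₗ cls
      J⊕x∈cls = ∈-cls⁺ strong (far-≡ J≁x ∈-⊕⁺ near)
        where
        near : ∀ {v} → v ∈ J ⊕ x → v ∈ J ⊎ v ~ x
        near v∈ with ∈-⊕⁻ v∈
        ... | inj₁ refl = inj₂ (~-refl x)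
        ... | inj₂ v∈J  = inj₁ v∈J
        strong : Strong (J ⊕ x)
        strong u~v u∈ v∈ with ∈-⊕⁻ u∈ | ∈-⊕⁻ v∈
        ... | inj₁ refl | inj₁ refl = refl
        ... | inj₁ refl | inj₂ v∈J  = ⊥-elim (J≁x v∈J (~-sym u~v))
        ... | inj₂ u∈J  | inj₁ refl = ⊥-elim (J≁x u∈J u~v)
        ... | inj₂ u∈J  | inj₂ v∈J  = J-strong u~v u∈J v∈J

      total : ℕ
      total = ∑ cls w

      -- The class contains J ⊕ x, of relative weight λ, and all extensions of J by chosen vertices,
      -- of total relative weight (1 + λ)^m. There is no overlap, as `x` is never chosen.
      total-lower : (q * (q + p) ^ m + p * q ^ m) * w J ≤ q * q ^ m * total
      total-lower = begin
        (q * (q + p) ^ m + p * q ^ m) * w J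
          ≡⟨ r₁ q ((q + p) ^ m) p (q ^ m) (w J) ⟩
        q ^ m * (p * w J) + q * ((q + p) ^ m * w J)
          ≡⟨ cong₂ (λ s t → q ^ m * s + q * t) (sym (weight-⊕ p q x∉J))
               (subst (λ l → (q + p) ^ l * w J ≡ q ^ l * ∑ (adjoin ys J) w) (length-map chosen opens)
                 (sym (∑-adjoin p q ys-unique ys∉J))) ⟩
        q ^ m * (q * w (J ⊕ x)) + q * (q ^ m * ∑ (adjoin ys J) w)
          ≡⟨ r₂ q (q ^ m) (w (J ⊕ x)) (∑ (adjoin ys J) w) ⟩
        q * q ^ m * ∑ (J ⊕ x ∷ adjoin ys J) w
          ≤⟨ *-monoʳ-≤ (q * q ^ m) (∑-⊆ w (All.tabulate new ∷ adjoin-unique ys-unique ys∉J)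
               (λ { (here refl) → J⊕x∈cls ; (there S∈) → adjoin∈cls S∈ })) ⟩
        q * q ^ m * total ∎
        where
        open ≤-Reasoning
        ys∉J : ∀ {y} → y ∈ₗ ys → y ∉ J
        ys∉J y∈ y∈J = J≁x y∈J (ys~x y∈)
        new : ∀ {S} → S ∈ₗ adjoin ys J → J ⊕ x ≢ S
        new S∈ refl = ∉-adjoin ys x∉J x∉ys S∈ (x∈I⊕x J x)
        r₁ : ∀ q s p t z → (q * s + p * t) * z ≡ t * (p * z) + q * (s * z)
        r₁ = solve-∀
        r₂ : ∀ q t a b → t * (q * a) + q * (t * b) ≡ q * t * (a + b)
        r₂ = solve-∀

      -- Under `R` at most one vertex of the set is near `x`, and it comes from `vs`, so the set is
      -- J or some J ⊕ v.
      near-upper : ∀ {R : Subset n → Set} (R? : Decidable R) (vs : List (Fin n)) → (∀ {v} → v ∈ₗ vs → v ~ x) →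
        (∀ {I} → I ∈ₗ cls → R I → ∀ {u} → u ∈ I → u ~ x → u ∈ₗ vs × (∀ {v} → v ∈ I → v ~ x → v ≡ u)) →
        q * ∑ cls (λ I → ⟦ R? I ⟧ * w I) ≤ (q + length vs * p) * w J
      near-upper R? vs vs~x only = begin
        q * ∑ cls (λ I → ⟦ R? I ⟧ * w I)
          ≡⟨ cong (q *_) (∑-filter R? cls w) ⟨
        q * ∑ (filter R? cls) w
          ≤⟨ *-monoʳ-≤ q (∑-⊆ w (Unique.filter⁺ R? cls-unique) listed) ⟩
        q * ∑ (J ∷ map (J ⊕_) vs) w
          ≡⟨ trans (*-distribˡ-+ q (w J) _) (cong (q * w J +_) (trans (cong (q *_) (∑-map (J ⊕_) vs w)) (*-distribˡ-∑ q vs _))) ⟩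
        q * w J + ∑ vs (λ v → q * w (J ⊕ v))
          ≡⟨ cong (q * w J +_) (trans (∑-cong vs (λ v∈ → weight-⊕ p q (λ v∈J → J≁x v∈J (vs~x v∈)))) (∑-const vs _)) ⟩
        q * w J + length vs * (p * w J)
          ≡⟨ r q (w J) (length vs) p ⟩
        (q + length vs * p) * w J ∎
        where
        open ≤-Reasoning
        r : ∀ q z l p → q * z + l * (p * z) ≡ (q + l * p) * z
        r = solve-∀
        listed : ∀ {I} → I ∈ₗ filter R? cls → I ∈ₗ J ∷ map (J ⊕_) vs
        listed {I} I∈ with ∈-filter⁻ R? I∈ | any? (λ u → (u ∈? I) ×-dec (u ~? x))
        ... | I∈cls , _ | no none = here (⊆-antisym (λ {u} u∈ → ∈J I∈cls u∈ (λ u~x → none (u , u∈ , u~x))) (J⊆ I∈cls))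
        ... | I∈cls , rI | yes (u , u∈I , u~x) with only I∈cls rI u∈I u~x
        ...   | u∈vs , same = there (subst (_∈ₗ map (J ⊕_) vs) (⊆-antisym to from) (∈-map⁺ (J ⊕_) u∈vs))
          where
          to : ∀ {v} → v ∈ J ⊕ u → v ∈ I
          to v∈ with ∈-⊕⁻ v∈
          ... | inj₁ refl = u∈I
          ... | inj₂ v∈J  = J⊆ I∈cls v∈J
          from : ∀ {v} → v ∈ I → v ∈ J ⊕ u
          from {v} v∈ with v ~? x
          ... | yes v~x = subst (_∈ J ⊕ u) (sym (same v∈ v~x)) (x∈I⊕x J u)
          ... | no v≁x  = ∈-⊕⁺ (∈J I∈cls v∈ v≁x)

      uncovered-upper : q * ∑ cls (λ I → ⟦ uncovered? I x ⟧ * w I) ≤ (q + p) * w J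
      uncovered-upper = subst (λ t → q * ∑ cls (λ I → ⟦ uncovered? I x ⟧ * w I) ≤ (q + t) * w J) (+-identityʳ p)
        (near-upper (λ I → uncovered? I x) (x ∷ []) (λ { (here refl) → ~-refl x })
          (λ _ unc {u} u∈ u~x → here (unc u u∈ u~x) , λ {v} v∈ v~x → trans (unc v v∈ v~x) (sym (unc u u∈ u~x))))

      -- When `x` is free in `e`, every vertex of the set near `x` lies in `e`, and independence
      -- allows at most one; the edge offers three candidates.
      free-upper : ∀ {e} → e ∈ₗ star x → q * ∑ cls (λ I → ⟦ free? I x e ⟧ * w I) ≤ (q + 3 * p) * w J
      free-upper {e} e∈ = let e∈E , x∈e = ∈-star⁻ e∈ in
        subst (λ l → q * ∑ cls (λ I → ⟦ free? I x e ⟧ * w I) ≤ (q + l * p) * w J) (trans (length-members e) (All.lookup uniform e∈E))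
          (near-upper (λ I → free? I x e) (members e) (λ v∈ → e , e∈E , ∈-members⁻ v∈ , x∈e)
            (λ I∈ free {u} u∈ u~x → ∈-members⁺ (free u u∈ u~x) ,
              λ {v} v∈ v~x → proj₁ (∈-cls⁻ I∈) (e , e∈E , free v v∈ v~x , free u u∈ u~x) v∈ u∈))

      freeOpen-upper : q * ∑ cls (λ I → freeOpenEdges I x * w I) ≤ m * (q + 3 * p) * w J
      freeOpen-upper = begin
        q * ∑ cls (λ I → freeOpenEdges I x * w I)
          ≡⟨ cong (q *_) (trans (∑-cong cls restrict) (∑-swap cls opens _)) ⟩
        q * ∑ opens (λ e → ∑ cls (λ I → ⟦ free? I x e ⟧ * w I))
          ≡⟨ *-distribˡ-∑ q opens _ ⟩
        ∑ opens (λ e → q * ∑ cls (λ I → ⟦ free? I x e ⟧ * w I))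
          ≤⟨ ∑-mono opens (λ e∈ → free-upper (proj₁ (∈-filter⁻ (open? J x) e∈))) ⟩
        ∑ opens (λ _ → (q + 3 * p) * w J)
          ≡⟨ trans (∑-const opens _) (sym (*-assoc m (q + 3 * p) (w J))) ⟩
        m * (q + 3 * p) * w J ∎
        where
        open ≤-Reasoning
        restrict : ∀ {I} → I ∈ₗ cls → freeOpenEdges I x * w I ≡ ∑ opens (λ e → ⟦ free? I x e ⟧ * w I)
        restrict {I} I∈ = begin-equality
          ∑ (star x) (λ e → ⟦ open? I x e ⟧ * ⟦ free? I x e ⟧) * w I
            ≡⟨ cong (_* w I) (trans (∑-cong (star x) (λ {e} e∈ → cong (_* ⟦ free? I x e ⟧) (⟦open⟧ I∈ e∈)))
                                    (sym (∑-filter (open? J x) (star x) (λ e → ⟦ free? I x e ⟧)))) ⟩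
          ∑ opens (λ e → ⟦ free? I x e ⟧) * w I
            ≡⟨ trans (*-comm _ (w I)) (trans (*-distribˡ-∑ (w I) opens _) (∑-cong opens (λ _ → *-comm (w I) _))) ⟩
          ∑ opens (λ e → ⟦ free? I x e ⟧ * w I) ∎

    -- Designed so that its sum over `x` is at least 3 d per uncovered vertex: the two edge sums
    -- yield 2 d by `edge-inequality`, the middle term the remaining d.
    score : Fin n → Subset n → ℕ
    score x I = openEdges I x + d * ⟦ uncovered? I x ⟧ + freeOpenEdges I x

    Y : ℕ
    Y = square (q + d * p)

    class-bound : ∀ x J → ∑ (class x J) (λ I → score x I * w I) * Y ≤ d * (Y + c * (q * q)) * ∑ (class x J) w
    class-bound x J = go (class x J) refl
      where
      go : ∀ xs → xs ≡ class x J → ∑ xs (λ I → score x I * w I) * Y ≤ d * (Y + c * (q * q)) * ∑ xs w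
      -- A set J that is no far part of an independent set has an empty class; otherwise the head of
      -- the list opens `Class`.
      go []        _  = z≤n
      go (I₀ ∷ xs) eq with ∈-filter⁻ (λ I → far x I ≟ˢ J) (subst (I₀ ∈ₗ_) eq (here refl))
      ... | I₀∈ , refl = subst (λ xs → ∑ xs (λ I → score x I * w I) * Y ≤ d * (Y + c * (q * q)) * ∑ xs w) (sym eq) main
        where
        open Class x I₀ I₀∈ hiding (J)
        U Q : ℕ
        U = ∑ cls (λ I → ⟦ uncovered? I x ⟧ * w I)
        Q = ∑ cls (λ I → freeOpenEdges I x * w I)
        split : ∑ cls (λ I → score x I * w I) ≡ m * total + d * U + Q
        split = begin
          ∑ cls (λ I → score x I * w I)
            ≡⟨ ∑-cong cls (λ {I} I∈ → trans (cong (λ t → (t + d * ⟦ uncovered? I x ⟧ + freeOpenEdges I x) * w I) (openEdges≡m I∈))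
                                            (r m d ⟦ uncovered? I x ⟧ (freeOpenEdges I x) (w I))) ⟩
          ∑ cls (λ I → m * w I + d * (⟦ uncovered? I x ⟧ * w I) + freeOpenEdges I x * w I)
            ≡⟨ trans (∑-distrib-+ cls _ _) (cong (_+ Q) (trans (∑-distrib-+ cls _ _)
                 (cong₂ _+_ (sym (*-distribˡ-∑ m cls w)) (sym (*-distribˡ-∑ d cls _))))) ⟩
          m * total + d * U + Q ∎
          where
          open ≡-Reasoning
          r : ∀ m d u f z → (m + d * u + f) * z ≡ m * z + d * (u * z) + f * z
          r = solve-∀
        main : ∑ cls (λ I → score x I * w I) * Y ≤ d * (Y + c * (q * q)) * total
        main with m≤n⇒∃[o]m+o≡n m≤d
        ... | g , m+g≡d = subst (λ s → s * Y ≤ d * (Y + c * (q * q)) * total) (sym split)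
          (subst (λ y → (m * total + d * U + Q) * square (q + y) ≤ d * (square (q + y) + c * (q * q)) * total) (*-comm p d)
            (subst (λ d → (m * total + d * U + Q) * square (q + p * d) ≤ d * (square (q + p * d) + c * (q * q)) * total) m+g≡d
              (local-bound q p m g total U Q (w (far x I₀)) p≤q total-lower uncovered-upper freeOpen-upper)))

    Z : ℕ
    Z = ∑ sets w

    vertex-bound : ∀ x → ∑ sets (λ I → score x I * w I) * Y ≤ d * (Y + c * (q * q)) * Z
    vertex-bound x = begin
      ∑ sets f * Y                                   ≡⟨ cong (_* Y) (fibres f) ⟩
      ∑ (subsets n) (λ J → ∑ (class x J) f) * Y       ≡⟨ trans (*-comm _ Y) (*-distribˡ-∑ Y (subsets n) _) ⟩
      ∑ (subsets n) (λ J → Y * ∑ (class x J) f)       ≤⟨ ∑-mono (subsets n) (λ {J} _ → ≤-trans (≤-reflexive (*-comm Y _)) (class-bound x J)) ⟩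
      ∑ (subsets n) (λ J → K * ∑ (class x J) w)       ≡⟨ *-distribˡ-∑ K (subsets n) _ ⟨
      K * ∑ (subsets n) (λ J → ∑ (class x J) w)       ≡⟨ cong (K *_) (fibres w) ⟨
      K * Z                                          ∎
      where
      open ≤-Reasoning
      f : Subset n → ℕ
      f I = score x I * w I
      K = d * (Y + c * (q * q))
      fibres : ∀ f → ∑ sets f ≡ ∑ (subsets n) (λ J → ∑ (class x J) f)
      fibres = ∑-fibres _≟ˢ_ (subsets-unique n) ∈-subsets (far x) sets

    uncovered-score : ∀ I → 3 * d * ∑ (allFin n) (λ x → ⟦ uncovered? I x ⟧) ≤ ∑ (allFin n) (λ x → score x I)
    uncovered-score I = begin
      3 * d * ∑ (allFin n) U
        ≡⟨ r d (∑ (allFin n) U) ⟩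
      d * (2 * ∑ (allFin n) U) + d * ∑ (allFin n) U
        ≡⟨ cong₂ _+_ (trans (cong (d *_) (*-distribˡ-∑ 2 (allFin n) U)) (*-distribˡ-∑ d (allFin n) _)) (*-distribˡ-∑ d (allFin n) U) ⟩
      ∑ (allFin n) (λ x → d * (2 * U x)) + ∑ (allFin n) (λ x → d * U x)
        ≡⟨ cong (_+ ∑ (allFin n) (λ x → d * U x)) (trans (∑-cong (allFin n) (λ {x} _ → constant x)) (∑-incidences _)) ⟩
      ∑ (edges G) (λ e → ∑ (members e) (λ x → 2 * U x)) + ∑ (allFin n) (λ x → d * U x)
        ≤⟨ +-monoˡ-≤ _ (∑-mono (edges G) (λ {e} e∈ → edge-inequality I e (All.lookup uniform e∈) e∈)) ⟩
      ∑ (edges G) (λ e → ∑ (members e) (λ x → T x e + T x e * F x e)) + ∑ (allFin n) (λ x → d * U x)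
        ≡⟨ cong (_+ ∑ (allFin n) (λ x → d * U x)) (trans (sym (∑-incidences _)) (∑-cong (allFin n) (λ {x} _ → ∑-distrib-+ (star x) _ _))) ⟩
      ∑ (allFin n) (λ x → openEdges I x + freeOpenEdges I x) + ∑ (allFin n) (λ x → d * U x)
        ≡⟨ trans (sym (∑-distrib-+ (allFin n) _ _)) (∑-cong (allFin n) (λ {x} _ → r′ (openEdges I x) (freeOpenEdges I x) (d * U x))) ⟩
      ∑ (allFin n) (λ x → score x I) ∎
      where
      open ≤-Reasoning
      U : Fin n → ℕ
      U x = ⟦ uncovered? I x ⟧
      T F : Fin n → Subset n → ℕ
      T x e = ⟦ open? I x e ⟧
      F x e = ⟦ free? I x e ⟧
      r : ∀ d u → 3 * d * u ≡ d * (2 * u) + d * u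
      r = solve-∀
      r′ : ∀ a b u → a + b + u ≡ a + u + b
      r′ = solve-∀
      constant : ∀ x → d * (2 * U x) ≡ ∑ (star x) (λ _ → 2 * U x)
      constant x = sym (trans (∑-const (star x) (2 * U x)) (cong (_* (2 * U x)) (length-star x)))

    uncovered-total : Fin n → ℕ
    uncovered-total x = ∑ sets (λ I → ⟦ uncovered? I x ⟧ * w I)

    uncovered-bound : 3 * ∑ (allFin n) uncovered-total * Y ≤ n * (Y + c * (q * q)) * Z
    uncovered-bound = *-cancelˡ-≤ d (begin
      d * (3 * ∑ (allFin n) uncovered-total * Y)
        ≡⟨ r₁ d (∑ (allFin n) uncovered-total) Y ⟩
      3 * d * ∑ (allFin n) uncovered-total * Y
        ≡⟨ cong (λ t → 3 * d * t * Y) (∑-swap (allFin n) sets _) ⟩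
      3 * d * ∑ sets (λ I → ∑ (allFin n) (λ x → ⟦ uncovered? I x ⟧ * w I)) * Y
        ≡⟨ cong (_* Y) (*-distribˡ-∑ (3 * d) sets _) ⟩
      ∑ sets (λ I → 3 * d * ∑ (allFin n) (λ x → ⟦ uncovered? I x ⟧ * w I)) * Y
        ≤⟨ *-monoˡ-≤ Y (∑-mono sets (λ {I} _ → weighted I)) ⟩
      ∑ sets (λ I → ∑ (allFin n) (λ x → score x I * w I)) * Y
        ≡⟨ cong (_* Y) (∑-swap sets (allFin n) _) ⟩
      ∑ (allFin n) (λ x → ∑ sets (λ I → score x I * w I)) * Y
        ≡⟨ trans (*-comm _ Y) (*-distribˡ-∑ Y (allFin n) _) ⟩
      ∑ (allFin n) (λ x → Y * ∑ sets (λ I → score x I * w I))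
        ≤⟨ ∑-mono (allFin n) (λ {x} _ → ≤-trans (≤-reflexive (*-comm Y _)) (vertex-bound x)) ⟩
      ∑ (allFin n) (λ _ → d * (Y + c * (q * q)) * Z)
        ≡⟨ trans (∑-const (allFin n) _) (cong (_* (d * (Y + c * (q * q)) * Z)) (length-tabulate {n = n} id)) ⟩
      n * (d * (Y + c * (q * q)) * Z)
        ≡⟨ r₂ n d (Y + c * (q * q)) Z ⟩
      d * (n * (Y + c * (q * q)) * Z) ∎)
      where
      open ≤-Reasoning
      r₁ : ∀ d u y → d * (3 * u * y) ≡ 3 * d * u * y
      r₁ = solve-∀
      r₂ : ∀ n d y z → n * (d * y * z) ≡ d * (n * y * z)
      r₂ = solve-∀
      factor : ∀ (f : Fin n → ℕ) z → ∑ (allFin n) (λ x → f x * z) ≡ z * ∑ (allFin n) f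
      factor f z = trans (∑-cong (allFin n) (λ {x} _ → *-comm (f x) z)) (sym (*-distribˡ-∑ z (allFin n) f))
      weighted : ∀ I → 3 * d * ∑ (allFin n) (λ x → ⟦ uncovered? I x ⟧ * w I) ≤ ∑ (allFin n) (λ x → score x I * w I)
      weighted I = begin
        3 * d * ∑ (allFin n) (λ x → ⟦ uncovered? I x ⟧ * w I)    ≡⟨ cong (3 * d *_) (factor _ (w I)) ⟩
        3 * d * (w I * ∑ (allFin n) (λ x → ⟦ uncovered? I x ⟧))  ≡⟨ x∙yz≈y∙xz (3 * d) (w I) _ ⟩
        w I * (3 * d * ∑ (allFin n) (λ x → ⟦ uncovered? I x ⟧))  ≤⟨ *-monoʳ-≤ (w I) (uncovered-score I) ⟩
        w I * ∑ (allFin n) (λ x → score x I)                     ≡⟨ factor _ (w I) ⟨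
        ∑ (allFin n) (λ x → score x I * w I)                     ∎

    -- An uncovered vertex is occupied with probability λ / (1 + λ). Deleting `x` injects the
    -- occupied sets into the uncovered ones avoiding `x`, which handles the share `q`; for the
    -- share `p`, an occupied vertex is itself uncovered.
    occupied-bound : ∀ x → (q + p) * ∑ sets (λ I → ⟦ x ∈? I ⟧ * w I) ≤ p * uncovered-total x
    occupied-bound x = begin
      (q + p) * ∑ sets (λ I → ⟦ x ∈? I ⟧ * w I)
        ≡⟨ cong ((q + p) *_) (∑-filter (x ∈?_) sets w) ⟨
      (q + p) * ∑ occ w
        ≡⟨ trans (*-distribʳ-+ (∑ occ w) q p) (cong₂ _+_ (*-distribˡ-∑ q occ w) (*-distribˡ-∑ p occ w)) ⟩
      ∑ occ (λ I → q * w I) + ∑ occ (λ I → p * w I)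
        ≤⟨ +-mono-≤ (∑-injection (_⊖ x) occ-unique removed removed-injective (λ I∈ → ≤-reflexive (weight-⊖ p q (x∈ I∈))))
                    (∑-⊆ (λ I → p * w I) occ-unique kept) ⟩
      ∑ out (λ I → p * w I) + ∑ inn (λ I → p * w I)
        ≡⟨ trans (cong₂ _+_ (∑-filter out? sets _) (∑-filter inn? sets _)) (sym (∑-distrib-+ sets _ _)) ⟩
      ∑ sets (λ I → ⟦ out? I ⟧ * (p * w I) + ⟦ inn? I ⟧ * (p * w I))
        ≡⟨ ∑-cong sets (λ {I} _ → trans (sym (*-distribʳ-+ (p * w I) ⟦ out? I ⟧ ⟦ inn? I ⟧))
             (trans (cong (_* (p * w I)) (either I)) (r ⟦ uncovered? I x ⟧ p (w I)))) ⟩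
      ∑ sets (λ I → p * (⟦ uncovered? I x ⟧ * w I))
        ≡⟨ *-distribˡ-∑ p sets _ ⟨
      p * uncovered-total x ∎
      where
      open ≤-Reasoning
      occ : List (Subset n)
      occ = filter (x ∈?_) sets
      out? : Decidable (λ I → x ∉ I × Uncovered I x)
      out? I = ¬? (x ∈? I) ×-dec uncovered? I x
      inn? : Decidable (λ I → x ∈ I × Uncovered I x)
      inn? I = (x ∈? I) ×-dec uncovered? I x
      out inn : List (Subset n)
      out = filter out? sets
      inn = filter inn? sets
      occ-unique : Unique occ
      occ-unique = Unique.filter⁺ (x ∈?_) sets-unique
      ∈occ⁻ : ∀ {I} → I ∈ₗ occ → I ∈ₗ sets × x ∈ I
      ∈occ⁻ = ∈-filter⁻ (x ∈?_)
      x∈ : ∀ {I} → I ∈ₗ occ → x ∈ I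
      x∈ = proj₂ ∘ ∈occ⁻
      uncov : ∀ {I} → I ∈ₗ occ → Uncovered I x
      uncov I∈ u u∈ u~x = ∈-sets⁻ (proj₁ (∈occ⁻ I∈)) u~x u∈ (x∈ I∈)
      kept : ∀ {I} → I ∈ₗ occ → I ∈ₗ inn
      kept I∈ = ∈-filter⁺ inn? (proj₁ (∈occ⁻ I∈)) (x∈ I∈ , uncov I∈)
      removed : ∀ {I} → I ∈ₗ occ → I ⊖ x ∈ₗ out
      removed {I} I∈ = ∈-filter⁺ out? (∈-sets⁺ (λ u~v u∈ v∈ → ∈-sets⁻ (proj₁ (∈occ⁻ I∈)) u~v (∈-⊖⁻ u∈) (∈-⊖⁻ v∈)))
        (x∉I⊖x I x , λ u u∈ u~x → uncov I∈ u (∈-⊖⁻ u∈) u~x)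
      removed-injective : ∀ {I I′} → I ∈ₗ occ → I′ ∈ₗ occ → I ⊖ x ≡ I′ ⊖ x → I ≡ I′
      removed-injective I∈ I′∈ eq = trans (sym (⊖-⊕ (x∈ I∈))) (trans (cong (_⊕ x) eq) (⊖-⊕ (x∈ I′∈)))
      either : ∀ I → ⟦ out? I ⟧ + ⟦ inn? I ⟧ ≡ ⟦ uncovered? I x ⟧
      either I with x ∈? I
      ... | yes _ = refl
      ... | no _  = +-identityʳ _
      r : ∀ u p z → u * (p * z) ≡ p * (u * z)
      r = solve-∀

    size-bound : (q + p) * ∑ sets (λ I → ∣ I ∣ * w I) ≤ p * ∑ (allFin n) uncovered-total
    size-bound = begin
      (q + p) * ∑ sets (λ I → ∣ I ∣ * w I)
        ≡⟨ cong ((q + p) *_) (trans (∑-cong sets (λ {I} _ → expand I)) (∑-swap sets (allFin n) _)) ⟩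
      (q + p) * ∑ (allFin n) (λ x → ∑ sets (λ I → ⟦ x ∈? I ⟧ * w I))
        ≡⟨ *-distribˡ-∑ (q + p) (allFin n) _ ⟩
      ∑ (allFin n) (λ x → (q + p) * ∑ sets (λ I → ⟦ x ∈? I ⟧ * w I))
        ≤⟨ ∑-mono (allFin n) (λ {x} _ → occupied-bound x) ⟩
      ∑ (allFin n) (λ x → p * uncovered-total x)
        ≡⟨ *-distribˡ-∑ p (allFin n) _ ⟨
      p * ∑ (allFin n) uncovered-total ∎
      where
      open ≤-Reasoning
      expand : ∀ I → ∣ I ∣ * w I ≡ ∑ (allFin n) (λ x → ⟦ x ∈? I ⟧ * w I)
      expand I = trans (cong (_* w I) (∣∣≡∑ I)) (trans (*-comm _ (w I))
        (trans (*-distribˡ-∑ (w I) (allFin n) _) (∑-cong (allFin n) (λ _ → *-comm (w I) _))))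

  -- From the partition function to the number of independent sets

  ∑-weight-subsets : ∀ p q n → ∑ (subsets n) (weight p q) ≡ (q + p) ^ n
  ∑-weight-subsets p q zero    = refl
  ∑-weight-subsets p q (suc n) = begin
    ∑ (map (outside Vec.∷_) (subsets n) ++ map (inside Vec.∷_) (subsets n)) (weight p q)
      ≡⟨ ∑-++ (map (outside Vec.∷_) (subsets n)) _ _ ⟩
    ∑ (map (outside Vec.∷_) (subsets n)) (weight p q) + ∑ (map (inside Vec.∷_) (subsets n)) (weight p q)
      ≡⟨ cong₂ _+_ (trans (∑-map (outside Vec.∷_) (subsets n) _) (sym (*-distribˡ-∑ q (subsets n) _)))
                   (trans (∑-map (inside Vec.∷_) (subsets n) _) (sym (*-distribˡ-∑ p (subsets n) _))) ⟩
    q * ∑ (subsets n) (weight p q) + p * ∑ (subsets n) (weight p q)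
      ≡⟨ *-distribʳ-+ (∑ (subsets n) (weight p q)) q p ⟨
    (q + p) * ∑ (subsets n) (weight p q)
      ≡⟨ cong ((q + p) *_) (∑-weight-subsets p q n) ⟩
    (q + p) * (q + p) ^ n ∎
    where open ≡-Reasoning

  weight-diagonal : ∀ q {n} (I : Subset n) → weight q q I ≡ q ^ n
  weight-diagonal q Vec.[]              = refl
  weight-diagonal q (inside  Vec.∷ I) = cong (q *_) (weight-diagonal q I)
  weight-diagonal q (outside Vec.∷ I) = cong (q *_) (weight-diagonal q I)

  length-subsets : ∀ n → length (subsets n) ≡ 2 ^ n
  length-subsets zero    = refl
  length-subsets (suc n) = trans (length-++ (map (outside Vec.∷_) (subsets n)))
    (cong₂ _+_ (trans (length-map _ (subsets n)) (length-subsets n))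
               (trans (length-map _ (subsets n)) (trans (length-subsets n) (sym (+-identityʳ (2 ^ n))))))

  module _ {n} (G : Hypergraph n) (d : ℕ) .{{d≢0 : NonZero d}}
    (uniform : Uniform G 3) (regular : Regular G d) (linear : Linear G) (crossFree : CrossEdgeFree G) where

    open Neighbourhoods G using (sets; sets-unique)

    partition : ℕ → ℕ → ℕ
    partition q p = ∑ sets (weight p q)

    -- The discrete form of (log Z)′ = E|I| / λ combined with the occupancy bound; the factor 3
    -- clears the 1/3.
    partition-step : ∀ q {{_ : NonZero q}} p′ → suc p′ ≤ q →
      let p = suc p′; E = square (q + d * p) * (q + p) in
      3 * E * partition q p ≤ 3 * E * partition q p′ + n * (square (q + d * p) + c * (q * q)) * partition q p
    partition-step q p′ p≤q = *-cancelˡ-≤ p (begin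
      p * (3 * E * Z)                                       ≡⟨ r₁ p E Z ⟩
      3 * E * (p * Z)                                       ≤⟨ *-monoʳ-≤ (3 * E) step ⟩
      3 * E * (p * Z′ + S)                                  ≡⟨ r₂ p Y (q + p) Z′ S ⟩
      p * (3 * E * Z′) + 3 * Y * ((q + p) * S)              ≤⟨ +-monoʳ-≤ (p * (3 * E * Z′)) (*-monoʳ-≤ (3 * Y) size-bound) ⟩
      p * (3 * E * Z′) + 3 * Y * (p * U)                    ≡⟨ cong (p * (3 * E * Z′) +_) (r₃ p Y U) ⟩
      p * (3 * E * Z′) + p * (3 * U * Y)                    ≤⟨ +-monoʳ-≤ (p * (3 * E * Z′)) (*-monoʳ-≤ p uncovered-bound) ⟩
      p * (3 * E * Z′) + p * (n * (Y + c * (q * q)) * Z)    ≡⟨ *-distribˡ-+ p (3 * E * Z′) (n * (Y + c * (q * q)) * Z) ⟨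
      p * (3 * E * Z′ + n * (Y + c * (q * q)) * Z)          ∎)
      where
      open ≤-Reasoning
      p = suc p′
      open HardCore G d uniform regular linear crossFree p q p≤q using (Z; Y; uncovered-total; uncovered-bound; size-bound)
      E = Y * (q + p)
      Z′ = partition q p′
      S = ∑ sets (λ I → ∣ I ∣ * weight p q I)
      U = ∑ (allFin n) uncovered-total
      step : p * Z ≤ p * Z′ + S
      step = begin
        p * Z                                                             ≡⟨ *-distribˡ-∑ p sets _ ⟩
        ∑ sets (λ I → p * weight p q I)                                   ≤⟨ ∑-mono sets (λ {I} _ → weight-step p′ q I) ⟩
        ∑ sets (λ I → p * weight p′ q I + ∣ I ∣ * weight p q I)            ≡⟨ ∑-distrib-+ sets _ _ ⟩
        ∑ sets (λ I → p * weight p′ q I) + S                              ≡⟨ cong (_+ S) (*-distribˡ-∑ p sets _) ⟨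
        p * Z′ + S                                                        ∎
      r₁ : ∀ p e z → p * (3 * e * z) ≡ 3 * e * (p * z)
      r₁ = solve-∀
      r₂ : ∀ p y r z s → 3 * (y * r) * (p * z + s) ≡ p * (3 * (y * r) * z) + 3 * y * (r * s)
      r₂ = solve-∀
      r₃ : ∀ p y u → 3 * y * (p * u) ≡ p * (3 * u * y)
      r₃ = solve-∀

    count-large : κ ≤ d → i₂ G ^ (3 * d) ≤ 2 ^ (n * (d + 2 * κ))
    count-large κ≤d = count-bound n q d κ (i₂ G)
      (subst (λ z → cube z * (q + d * q) ^ n ≤ (q * q * ((q + q) * (q + (d + κ) * q))) ^ n) final
        (potential-bound (partition-step q) initial q ≤-refl))
      where
      -- The mesh demanded by `potential-step`; the successor below keeps `q` nonzero even for n =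
      -- 0.
      N = n * ((1 + c) * (κ + 2 * square (1 + d)))
      q = suc N
      open Potential n q d (partition q) κ≤d (n≤1+n N)
      -- At p = 0 only the empty set has positive weight, so the sum over all subsets is already
      -- q^n.
      initial : partition q 0 ≤ q ^ n
      initial = ≤-trans (∑-⊆ (weight 0 q) sets-unique (λ {I} _ → ∈-subsets I))
        (≤-reflexive (trans (∑-weight-subsets 0 q n) (cong (_^ n) (+-identityʳ q))))
      final : partition q q ≡ i₂ G * q ^ n
      final = trans (∑-cong sets (λ {I} _ → weight-diagonal q I)) (∑-const sets (q ^ n))

    count : i₂ G ^ (3 * d) ≤ 2 ^ (n * (d + 3 * κ))
    count with κ ≤? d
    ... | yes κ≤d = ≤-trans (count-large κ≤d) (^-monoʳ-≤ 2 (*-monoʳ-≤ n (+-monoʳ-≤ d (*-monoˡ-≤ κ (n≤1+n 2)))))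
    -- For d < κ the count 2^n suffices, since 3 d = d + 2 d ≤ d + 3 κ.
    ... | no κ≰d = begin
      i₂ G ^ (3 * d)            ≤⟨ ^-monoˡ-≤ (3 * d) (≤-trans (length-filter (strongIndependent? G) (subsets n)) (≤-reflexive (length-subsets n))) ⟩
      (2 ^ n) ^ (3 * d)         ≡⟨ ^-*-assoc 2 n (3 * d) ⟩
      2 ^ (n * (3 * d))         ≤⟨ ^-monoʳ-≤ 2 (*-monoʳ-≤ n (+-monoʳ-≤ d (*-mono-≤ {2} {3} (n≤1+n 2) (<⇒≤ (≰⇒> κ≰d))))) ⟩
      2 ^ (n * (d + 3 * κ)) ∎
      where open ≤-Reasoning

open import Data.Nat using (ℕ; NonZero)
open import Data.Integer using (+_)
open import Data.Product using (_×_; _,_; ∃-syntax)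
open import Data.Rational using (ℚ; 0ℚ; _<_; _+_; _*_; _/_)
open import Data.Rational.Properties using (normalize-pos; positive⁻¹)
open Inequalities using (κ)
open Rationals using (log₂-bound)
open Occupancy using (count)

theorem6 : ∃[ C ] (0ℚ < C × (∀ (d : ℕ) .{{_ : NonZero d}} (n : ℕ) (G : Hypergraph n) →
    Uniform G 3 → Regular G d → Linear G → CrossEdgeFree G →
    log₂ i₂ G / n ≤ + 1 / 3 + C * (+ 1 / d)))
theorem6 =
  + κ / 1 ,
  positive⁻¹ (+ κ / 1) {{normalize-pos κ 1}} ,
  λ d n G uniform regular linear crossFree →
    log₂-bound κ d (i₂ G) n (count G d uniform regular linear crossFree)
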